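{- Let $q$ be a power of the odd prime $p$ and let $f$ be a planar function on $\mathbb F_{q^2}$ which either can be written as a Dembowski–Ostrom polynomial over $\mathbb F_{q^2}$ or is the Coulter–Matthews function $f(x)=x^{(3^k+1)/2}$ (with $p=3$, $q=3^n$, $\gcd(k,2n)=1$). Let $\theta\in\mathbb F_{q^2}^*$ be such that $\mathcal U_\theta:=\{(x,t\theta):x\in\mathbb F_{q^2},t\in\mathbb F_q\}\cup\{(\infty)\}$ is a unital in $\Pi(f)$. Then, as designs, $\mathcal U_\theta$ and the classical unital $\mathcal H$ of order $q$ are not isomorphic.
   Context: A Dembowski–Ostrom polynomial over $\mathbb F_{q^2}$ is one of the form $\sum_{i,j}a_{ij}x^{p^i+p^j}$ with $a_{ij}\in\mathbb F_{q^2}$; planar means $x\mapsto f(x+a)-f(x)$ is bijective for each $a\neq0$. $\Pi(f)$ is the projective plane with points $(x,y)\in\mathbb F_{q^2}^2$ and $(a)$ for $a\in\mathbb F_{q^2}\cup\{\infty\}$, lines $L_{a,b}=\{(x,f(x+a)-b):x\in\mathbb F_{q^2}\}\cup\{(a)\}$, $N_a=\{(a,y):y\in\mathbb F_{q^2}\}\cup\{(\infty)\}$ ($a,b\in\mathbb F_{q^2}$), $L_\infty=\{(a):a\in\mathbb F_{q^2}\cup\{\infty\}\}$. A unital in a projective plane of order $q^2$ is a set of $q^3+1$ points meeting every line in $1$ or $q+1$ points; it is regarded as a $2$-$(q^3+1,q+1,1)$ design whose blocks are its intersections with lines meeting it in $q+1$ points. The classical unital $\mathcal H$ is the Hermitian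 curve $\{(X:Y:Z)\in\mathrm{PG}(2,q^2):X^{q+1}+Y^{q+1}+Z^{q+1}=0\}$ with this design structure. Two designs are isomorphic if there is a bijection between their point sets mapping blocks onto blocks. -}

module Defs where

open import Algebra.Bundles using (CommutativeRing)
open import Algebra.Structures using (IsCommutativeRing)
import Algebra.Properties.Semiring.Exp as SemiringExp
import Algebra.Properties.Semiring.Sum as SemiringSum
import Algebra.Solver.Ring.NaturalCoefficients.Default as SemiringSolver
open import Data.Empty using (⊥)
open import Data.Fin.Base using (Fin; toℕ)
import Data.Nat.Base as ℕ
open ℕ using (ℕ; suc)
import Data.Nat.DivMod as ℕ
open import Data.Nat.GCD using (gcd)
open import Data.Product.Base using (Σ; ∃; ∃-syntax; _×_; _,_; proj₁; proj₂)
open import Data.Sum.Base using (_⊎_)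
open import Data.Unit.Base using (⊤)
open import Function.Bundles using (Inverse; _⇔_)
open import Function.Definitions using (Bijective)
open import Level using (0ℓ)
open import Relation.Binary.Bundles using (Setoid)
open import Relation.Binary.Definitions using (_Respects_)
import Relation.Binary.Construct.On as On
open import Relation.Binary.PropositionalEquality
open import Relation.Unary using (Pred; _∩_)

-- Elements of the subset are compared as elements of S, so the membership
-- proofs do not contribute to the count.
subsetoid : (S : Setoid 0ℓ 0ℓ) → Pred (Setoid.Carrier S) 0ℓ → Setoid 0ℓ 0ℓ
subsetoid S P = On.setoid {B = Σ (Setoid.Carrier S) P} S proj₁

HasSize : (S : Setoid 0ℓ 0ℓ) → Pred (Setoid.Carrier S) 0ℓ → ℕ → Set
HasSize S P m = Inverse (subsetoid S P) (setoid (Fin m))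

record FiniteField (order : ℕ) : Set₁ where
  infixl 6 _+_
  infixl 7 _*_
  field
    Carrier           : Set
    _+_ _*_           : Carrier → Carrier → Carrier
    -_                : Carrier → Carrier
    0# 1#             : Carrier
    isCommutativeRing : IsCommutativeRing _≡_ _+_ _*_ -_ 0# 1#
    1≢0               : 1# ≢ 0#
    inverse           : ∀ x → x ≢ 0# → ∃[ y ] x * y ≡ 1#
    enumeration       : Inverse (setoid Carrier) (setoid (Fin order))

  commutativeRing : CommutativeRing 0ℓ 0ℓ
  commutativeRing = record { isCommutativeRing = isCommutativeRing }

  open CommutativeRing commutativeRing public
    using (_-_; semiring; commutativeSemiring;
           *-assoc; *-comm; *-identityˡ; *-identityʳ; zeroˡ; zeroʳ)
  open SemiringExp semiring public using (_^_)
  open SemiringSum semiring public using (sum)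

module _ {order : ℕ} (F : FiniteField order) where
  open FiniteField F

  record IsSubfield (K : Pred Carrier 0ℓ) : Set where
    field
      0∈         : K 0#
      1∈         : K 1#
      +-closed   : ∀ {x y} → K x → K y → K (x + y)
      neg-closed : ∀ {x} → K x → K (- x)
      *-closed   : ∀ {x y} → K x → K y → K (x * y)
      inv-closed : ∀ {x y} → K x → x * y ≡ 1# → K y

  record IsSubfieldOfOrder (q : ℕ) (K : Pred Carrier 0ℓ) : Set where
    field
      isSubfield : IsSubfield K
      size       : HasSize (setoid Carrier) K q

  IsPlanar : (Carrier → Carrier) → Set
  IsPlanar f = ∀ a → a ≢ 0# → Bijective _≡_ _≡_ (λ x → f (x + a) - f x)

  IsDembowskiOstrom : ℕ → (Carrier → Carrier) → Set
  IsDembowskiOstrom p f =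
    ∃[ m ] Σ (Fin m → Fin m → Carrier) λ a → ∀ x →
      f x ≡ sum λ i → sum λ j → a i j * x ^ (p ℕ.^ toℕ i ℕ.+ p ℕ.^ toℕ j)

  -- 3 ^ k + 1 is even, so the natural-number quotient is exact.
  IsCoulterMatthews : (p n : ℕ) → (Carrier → Carrier) → Set
  IsCoulterMatthews p n f =
    p ≡ 3 ×
    (∃[ k ] gcd k (2 ℕ.* n) ≡ 1 × (∀ x → f x ≡ x ^ ((3 ℕ.^ k ℕ.+ 1) ℕ./ 2)))

-- A block may be listed several times; everything below depends only on
-- the point sets of the blocks.
record IncidenceStructure : Set₁ where
  field
    points  : Setoid 0ℓ 0ℓ
    Block   : Set
  open Setoid points public using (_≈_) renaming (Carrier to Point)
  field
    _on_    : Point → Block → Set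
    on-resp : ∀ ℓ → (_on ℓ) Respects _≈_

record _≅_ (D E : IncidenceStructure) : Set where
  private
    module D = IncidenceStructure D
    module E = IncidenceStructure E
  field
    bijection : Inverse D.points E.points
  open Inverse bijection using (to)

  _MapsOnto_ : D.Block → E.Block → Set
  B MapsOnto C = ∀ x → x D.on B ⇔ to x E.on C

  field
    block-image    : ∀ B → ∃[ C ] B MapsOnto C
    block-preimage : ∀ C → ∃[ B ] B MapsOnto C

module _ (P : IncidenceStructure) (q : ℕ) where
  open IncidenceStructure P

  -- The projective-plane axioms are not repeated here: for planar f they hold
  -- in the plane Π f below.
  record IsUnital (U : Pred Point 0ℓ) : Set where
    field
      size      : HasSize points U (q ℕ.^ 3 ℕ.+ 1)
      intersect : ∀ ℓ → HasSize points (U ∩ (_on ℓ)) 1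
                      ⊎ HasSize points (U ∩ (_on ℓ)) (q ℕ.+ 1)

  -- The structure induced on U by the lines meeting it in q + 1 points.
  design : Pred Point 0ℓ → IncidenceStructure
  design U = record
    { points  = subsetoid points U
    ; Block   = Σ Block λ ℓ → HasSize points (U ∩ (_on ℓ)) (q ℕ.+ 1)
    ; _on_    = λ x B → proj₁ x on proj₁ B
    ; on-resp = λ B → on-resp (proj₁ B)
    }

module _ {order : ℕ} (F : FiniteField order) where
  open FiniteField F

  data ShiftPoint : Set where
    pt  : (x y : Carrier) → ShiftPoint
    dir : (a : Carrier) → ShiftPoint
    ∞   : ShiftPoint

  data ShiftLine : Set where
    L  : (a b : Carrier) → ShiftLine
    N  : (a : Carrier) → ShiftLine
    L∞ : ShiftLine

  module _ (f : Carrier → Carrier) where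

    _onShift_ : ShiftPoint → ShiftLine → Set
    pt x y onShift L a b = y ≡ f (x + a) - b
    dir c  onShift L a b = c ≡ a
    ∞      onShift L a b = ⊥
    pt x y onShift N a   = x ≡ a
    dir c  onShift N a   = ⊥
    ∞      onShift N a   = ⊤
    pt x y onShift L∞    = ⊥
    dir c  onShift L∞    = ⊤
    ∞      onShift L∞    = ⊤

    Π : IncidenceStructure
    Π = record
      { points  = setoid ShiftPoint
      ; Block   = ShiftLine
      ; _on_    = _onShift_
      ; on-resp = λ ℓ → subst (_onShift ℓ)
      }

  U : (K : Pred Carrier 0ℓ) (θ : Carrier) → Pred ShiftPoint 0ℓ
  U K θ (pt x y) = ∃[ t ] K t × y ≡ t * θ
  U K θ (dir a)  = ⊥
  U K θ ∞        = ⊤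

module _ {order : ℕ} (F : FiniteField order) where
  open FiniteField F
  open ≡-Reasoning

  Triple : Set
  Triple = Carrier × Carrier × Carrier

  NonzeroTriple : Set
  NonzeroTriple = Σ Triple (_≢ (0# , 0# , 0#))

  _·_ : Carrier → Triple → Triple
  c · (X , Y , Z) = c * X , c * Y , c * Z

  private
    triple-≡ : ∀ {x y z x′ y′ z′ : Carrier} → x ≡ x′ → y ≡ y′ → z ≡ z′ →
               (x , y , z) ≡ (x′ , y′ , z′)
    triple-≡ refl refl refl = refl

    ·-identity : ∀ v → 1# · v ≡ v
    ·-identity _ = triple-≡ (*-identityˡ _) (*-identityˡ _) (*-identityˡ _)

    ·-assoc : ∀ c d v → (c * d) · v ≡ c · (d · v)
    ·-assoc c d _ = triple-≡ (*-assoc c d _) (*-assoc c d _) (*-assoc c d _)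

  Proportional : Triple → Triple → Set
  Proportional v w = ∃[ c ] c ≢ 0# × w ≡ c · v

  private
    prop-refl : ∀ {v} → Proportional v v
    prop-refl {v} = 1# , 1≢0 , sym (·-identity v)

    prop-sym : ∀ {v w} → Proportional v w → Proportional w v
    prop-sym {v} (c , c≢0 , refl) with inverse c c≢0
    ... | d , cd≡1 = d , d≢0 , (begin
        v           ≡⟨ sym (·-identity v) ⟩
        1# · v      ≡⟨ cong (_· v) (trans (sym cd≡1) (*-comm c d)) ⟩
        (d * c) · v ≡⟨ ·-assoc d c v ⟩
        d · (c · v) ∎)
      where
      d≢0 : d ≢ 0#
      d≢0 refl = 1≢0 (trans (sym cd≡1) (zeroʳ c))

    prop-trans : ∀ {u v w} → Proportional u v → Proportional v w → Proportional u w
    prop-trans {u} (c , c≢0 , refl) (d , d≢0 , refl) =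
      d * c , dc≢0 , sym (·-assoc d c u)
      where
      dc≢0 : d * c ≢ 0#
      dc≢0 dc≡0 with inverse d d≢0
      ... | e , de≡1 = c≢0 (begin
        c           ≡⟨ sym (*-identityˡ c) ⟩
        1# * c      ≡⟨ cong (_* c) (trans (sym de≡1) (*-comm d e)) ⟩
        (e * d) * c ≡⟨ *-assoc e d c ⟩
        e * (d * c) ≡⟨ cong (e *_) dc≡0 ⟩
        e * 0#      ≡⟨ zeroʳ e ⟩
        0#          ∎)

  _onPG_ : NonzeroTriple → NonzeroTriple → Set
  ((X , Y , Z) , _) onPG ((a , b , c) , _) = a * X + b * Y + c * Z ≡ 0#

  private
    scale-out : ∀ a b c k X Y Z →
                a * (k * X) + b * (k * Y) + c * (k * Z) ≡ k * (a * X + b * Y + c * Z)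
    scale-out = solve 7 (λ a b c k X Y Z →
      a :* (k :* X) :+ b :* (k :* Y) :+ c :* (k :* Z)
        := k :* (a :* X :+ b :* Y :+ c :* Z)) refl
      where open SemiringSolver commutativeSemiring

  -- Points are nonzero triples up to proportionality; lines are given by
  -- their nonzero coefficient triples.
  PG2 : IncidenceStructure
  PG2 = record
    { points  = record
        { Carrier       = NonzeroTriple
        ; _≈_           = λ v w → Proportional (proj₁ v) (proj₁ w)
        ; isEquivalence = record
            { refl = prop-refl ; sym = prop-sym ; trans = prop-trans }
        }
    ; Block   = NonzeroTriple
    ; _on_    = _onPG_
    ; on-resp = λ where
        ((a , b , c) , _) {(X , Y , Z) , _} (k , _ , refl) e →
          trans (scale-out a b c k X Y Z) (trans (cong (k *_) e) (zeroʳ k))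
    }

  HermitianCurve : ℕ → Pred NonzeroTriple 0ℓ
  HermitianCurve q ((X , Y , Z) , _) =
    X ^ (q ℕ.+ 1) + Y ^ (q ℕ.+ 1) + Z ^ (q ℕ.+ 1) ≡ 0#

  classicalUnital : ℕ → IncidenceStructure
  classicalUnital q = design PG2 q (HermitianCurve q)

{-# OPTIONS --safe #-}

-- Write z ᶜ for z ^ q. Take an isomorphism onto the Hermitian curve and use
-- coordinates in which ∞ goes to (0 : 0 : 1) and the other points of the curve
-- are the pairs (γ , α) with α + α ᶜ ≡ γ γ ᶜ. The blocks through ∞ are the fibres
-- of γ, and the γ-coordinates of any other block form a circle γ γ ᶜ ≡ tr (k γ) + t,
-- k being the slope of the block; three points of the γ-plane lie on a common
-- circle exactly when they are not collinear over the subfield of order q, and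
-- then on only one.
--
-- Both kinds of f are even, so (x , y) ↦ (2m − x , y) is for each m an involution
-- of the shift unital that fixes the points over m. Transported to the γ-plane it
-- fixes a single point M and preserves collinearity. It fixes every line through
-- M: otherwise a circle through M would be invariant, and the q + 1 points of a
-- block over it would be permuted by an involution with exactly one fixed point.
-- So it is the point reflection in M, which forces it to be the map
-- (γ , α) ↦ (2M − γ , α − 2 M ᶜ (γ − M)). In the shift unital the reflections
-- satisfy ι(2m) ι(n) (0 , 0) = ι(2m − n) (0 , 0); on the Hermitian side this fails.

module Submission where

open import Defs
open import Algebra.Bundles using (CommutativeMonoid; CommutativeRing; RawRing)
import Algebra.Properties.CommutativeMonoid.Sum as CommutativeMonoidSum
import Algebra.Properties.CommutativeSemiring.Binomial as Binomial
import Algebra.Properties.CommutativeSemiring.Exp as CommutativeSemiringExp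
import Algebra.Properties.Ring as RingProperties
import Algebra.Properties.Semiring.Exp as SemiringExp
import Algebra.Properties.Semiring.Mult as SemiringMult
import Algebra.Properties.Semiring.Mult.TCOptimised as SemiringMultTC
import Algebra.Properties.Semiring.Sum as SemiringSum
import Algebra.Solver.Ring as RingSolver
open import Algebra.Solver.Ring.AlmostCommutativeRing using (fromCommutativeRing; _-Raw-AlmostCommutative⟶_)
open import Data.Empty using (⊥; ⊥-elim)
open import Data.Fin.Base as Fin using (Fin; zero; suc; toℕ; punchIn; fromℕ; inject₁)
import Data.Fin.Properties as Fin
import Data.Integer.Base
import Data.Integer.Base as ℤ
import Data.Integer.Properties as ℤ
import Data.Maybe.Base as Maybe
import Data.Nat.Base as ℕ
open ℕ using (ℕ; zero; suc)
open import Data.Nat.Combinatorics using (_C_; nCk≡n!/k![n-k]!; k![n∸k]!∣n!; nCn≡1; nCk≡nC[n∸k])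
open import Data.Nat.Divisibility using (_∣_; _∤_; divides; m∣m*n; ∣1⇒≡1; ∣⇒≤; ∣m+n∣m⇒∣n)
import Data.Nat.DivMod as ℕ
open import Data.Nat.GCD using (gcd; gcd-greatest)
open import Data.Nat.Primality using (Prime; euclidsLemma; ¬prime[0]; ¬prime[1])
import Data.Nat.Properties as ℕ
import Data.Nat.Solver as ℕ-Solver
open import Data.Product.Base using (Σ; ∃; ∃-syntax; _×_; _,_; proj₁; proj₂)
open import Data.Sum.Base using (_⊎_; inj₁; inj₂; [_,_]′)
open import Data.Unit.Base using (tt)
open import Function.Base using (_∘_)
open import Function.Bundles using (Equivalence; Injection; Inverse; _↔_; _⇔_; mk↔ₛ′)
open import Function.Properties.Inverse using (↔⇒↣)
open import Level using (0ℓ)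
open import Relation.Binary.Bundles using (Setoid)
open import Relation.Binary.Consequences using (dec⇒weaklyDec)
open import Relation.Binary.Definitions using (DecidableEquality; tri<; tri≈; tri>)
import Relation.Binary.PropositionalEquality as ≡
open ≡ using (_≡_; _≢_)
open import Relation.Nullary.Decidable using (Dec; yes; no; map′)
open import Relation.Nullary.Negation using (¬_)
open import Relation.Unary using (Pred; _∩_)

-- The isomorphism is only known to respect blocks; no collineation of the ambient planes comes with
-- it. A reflection of the shift unital therefore reaches the γ-plane merely as a permutation of the
-- affine plane over the subfield that preserves collinearity, and it has to be recognised as a
-- dilatation by hand: it acts on each line through M by a scalar of the subfield, the scalars of
-- different lines agree, and the common scalar has square 1 but is not 1.
--
-- The contradiction is a clash of groups. Products of two reflections act on the shift unital as
-- translations of x, which commute. On the curve such products are maps (γ , α) ↦ (γ + c , α + c ᶜ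
-- γ + d) of a Heisenberg group, and two of them commute only if their translation parts c are
-- dependent over the subfield. The failure is a multiple of a determinant, so two centres
-- independent over the subfield expose it; a skew element, taken from a second point of the block
-- over γ = 0, supplies them.

-- Ring solver with integer coefficients

module IntegerCoefficients (R : CommutativeRing 0ℓ 0ℓ) where
  open Data.Integer.Base using (ℤ; +_; -[1+_]; _⊖_)
  open CommutativeRing R hiding (_-_)
  open RingProperties ring using (-0#≈0#; -‿distribˡ-*; -‿distribʳ-*; -‿involutive; -‿+-comm)
  open SemiringMultTC semiring renaming (_×_ to _×′_) using (×-homo-+; ×1-homo-*; 1+×)
  import Relation.Binary.Reasoning.Setoid setoid as ≈-Reasoning
  open ≈-Reasoning

  -- The canonical homomorphism. Equality of integer coefficients is decidable, which lets the
  -- solver cancel opposite terms and collect constants.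
  fromℤ : ℤ → Carrier
  fromℤ (+ n)    = n ×′ 1#
  fromℤ -[1+ n ] = - (suc n ×′ 1#)

  private
    cancel-1 : ∀ x y → (1# + x) + - (1# + y) ≈ x + - y
    cancel-1 x y = begin
      (1# + x) + - (1# + y)     ≈⟨ +-cong (+-comm 1# x) (sym (-‿+-comm 1# y)) ⟩
      (x + 1#) + (- 1# + - y)   ≈⟨ +-assoc x 1# _ ⟩
      x + (1# + (- 1# + - y))   ≈⟨ +-congˡ (+-assoc 1# (- 1#) _) ⟨
      x + ((1# + - 1#) + - y)   ≈⟨ +-congˡ (+-congʳ (-‿inverseʳ 1#)) ⟩
      x + (0# + - y)            ≈⟨ +-congˡ (+-identityˡ _) ⟩
      x + - y                   ∎

    fromℤ-⊖ : ∀ m n → fromℤ (m ⊖ n) ≈ m ×′ 1# + - (n ×′ 1#)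
    fromℤ-⊖ zero    zero    = sym (-‿inverseʳ 0#)
    fromℤ-⊖ zero    (suc n) = sym (+-identityˡ _)
    fromℤ-⊖ (suc m) zero    = begin
      suc m ×′ 1#         ≈⟨ +-identityʳ _ ⟨
      suc m ×′ 1# + 0#    ≈⟨ +-congˡ -0#≈0# ⟨
      suc m ×′ 1# + - 0#  ∎
    fromℤ-⊖ (suc m) (suc n) = begin
      fromℤ (suc m ⊖ suc n)        ≡⟨ ≡.cong fromℤ (ℤ.[1+m]⊖[1+n]≡m⊖n m n) ⟩
      fromℤ (m ⊖ n)                ≈⟨ fromℤ-⊖ m n ⟩
      m ×′ 1# + - (n ×′ 1#)          ≈⟨ cancel-1 _ _ ⟨
      (1# + m ×′ 1#) + - (1# + n ×′ 1#)
                                   ≈⟨ +-cong (1+× m 1#) (-‿cong (1+× n 1#)) ⟨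
      suc m ×′ 1# + - (suc n ×′ 1#)  ∎

    fromℤ-neg : ∀ i → fromℤ (ℤ.- i) ≈ - fromℤ i
    fromℤ-neg (+ zero)  = sym -0#≈0#
    fromℤ-neg (+ suc n) = refl
    fromℤ-neg -[1+ n ]  = sym (-‿involutive _)

    fromℤ-+ : ∀ i j → fromℤ (i ℤ.+ j) ≈ fromℤ i + fromℤ j
    fromℤ-+ (+ m)    (+ n)    = ×-homo-+ 1# m n
    fromℤ-+ (+ m)    -[1+ n ] = fromℤ-⊖ m (suc n)
    fromℤ-+ -[1+ m ] (+ n)    = trans (fromℤ-⊖ n (suc m)) (+-comm _ _)
    fromℤ-+ -[1+ m ] -[1+ n ] = begin
      - (suc (suc (m ℕ.+ n)) ×′ 1#)         ≡⟨ ≡.cong (λ k → - (suc k ×′ 1#)) (ℕ.+-suc m n) ⟨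
      - ((suc m ℕ.+ suc n) ×′ 1#)           ≈⟨ -‿cong (×-homo-+ 1# (suc m) (suc n)) ⟩
      - (suc m ×′ 1# + suc n ×′ 1#)          ≈⟨ -‿+-comm _ _ ⟨
      - (suc m ×′ 1#) + - (suc n ×′ 1#)      ∎

    fromℤ-neg-* : ∀ i j → fromℤ (i ℤ.* j) ≈ fromℤ i * fromℤ j →
                  fromℤ ((ℤ.- i) ℤ.* j) ≈ fromℤ (ℤ.- i) * fromℤ j
    fromℤ-neg-* i j eq = begin
      fromℤ ((ℤ.- i) ℤ.* j)      ≡⟨ ≡.cong fromℤ (ℤ.neg-distribˡ-* i j) ⟨
      fromℤ (ℤ.- (i ℤ.* j))      ≈⟨ fromℤ-neg (i ℤ.* j) ⟩
      - fromℤ (i ℤ.* j)          ≈⟨ -‿cong eq ⟩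
      - (fromℤ i * fromℤ j)      ≈⟨ -‿distribˡ-* _ _ ⟩
      - fromℤ i * fromℤ j        ≈⟨ *-congʳ (fromℤ-neg i) ⟨
      fromℤ (ℤ.- i) * fromℤ j    ∎

    fromℤ-+* : ∀ m j → fromℤ (+ m ℤ.* j) ≈ fromℤ (+ m) * fromℤ j
    fromℤ-+* m (+ n)    = begin
      fromℤ (+ m ℤ.* + n)  ≡⟨ ≡.cong fromℤ (ℤ.pos-* m n) ⟨
      (m ℕ.* n) ×′ 1#       ≈⟨ ×1-homo-* m n ⟩
      m ×′ 1# * n ×′ 1#      ∎
    fromℤ-+* m -[1+ n ] = begin
      fromℤ (+ m ℤ.* -[1+ n ])      ≡⟨ ≡.cong fromℤ (ℤ.neg-distribʳ-* (+ m) (+ suc n)) ⟨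
      fromℤ (ℤ.- (+ m ℤ.* + suc n)) ≈⟨ fromℤ-neg (+ m ℤ.* + suc n) ⟩
      - fromℤ (+ m ℤ.* + suc n)     ≈⟨ -‿cong (fromℤ-+* m (+ suc n)) ⟩
      - (m ×′ 1# * suc n ×′ 1#)       ≈⟨ -‿distribʳ-* _ _ ⟩
      m ×′ 1# * - (suc n ×′ 1#)       ∎

    fromℤ-* : ∀ i j → fromℤ (i ℤ.* j) ≈ fromℤ i * fromℤ j
    fromℤ-* (+ m)    j = fromℤ-+* m j
    fromℤ-* -[1+ m ] j = fromℤ-neg-* (+ suc m) j (fromℤ-+* (suc m) j)

  ℤ-rawRing : RawRing 0ℓ 0ℓ
  ℤ-rawRing = CommutativeRing.rawRing ℤ.+-*-commutativeRing

  morphism : ℤ-rawRing -Raw-AlmostCommutative⟶ fromCommutativeRing R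
  morphism = record
    { ⟦_⟧    = fromℤ
    ; +-homo = fromℤ-+
    ; *-homo = fromℤ-*
    ; -‿homo = fromℤ-neg
    ; 0-homo = refl
    ; 1-homo = refl
    }

  open RingSolver ℤ-rawRing (fromCommutativeRing R) morphism
    (λ i j → Maybe.map (λ eq → reflexive (≡.cong fromℤ eq)) (dec⇒weaklyDec ℤ._≟_ i j)) public

  -- With the optimised multiples, `con (+ 2)` evaluates definitionally to `1# + 1#`, so that solver
  -- identities apply directly to `two` below.
  :0 :1 :2 : ∀ {n} → Polynomial n
  :0 = con (+ 0)
  :1 = con (+ 1)
  :2 = con (+ 2)

module _ (M : CommutativeMonoid 0ℓ 0ℓ) where
  open CommutativeMonoid M
  open CommutativeMonoidSum M using (sum; sum-remove; sum-cong-≋; sum-replicate-zero)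

  sum-single : ∀ {n} (f : Fin n → Carrier) i → (∀ j → j ≢ i → f j ≈ ε) → sum f ≈ f i
  sum-single {suc n} f i vanish =
    trans (sum-remove {i = i} f)
      (trans (∙-congˡ (trans (sum-cong-≋ λ j → vanish (punchIn i j) (Fin.punchInᵢ≢i i j))
                             (sum-replicate-zero n)))
             (identityʳ (f i)))

open ≡ using (refl; sym; trans; cong; cong₂; subst; subst₂; module ≡-Reasoning)

-- Linear certificates and cancellation in a field

module FieldProperties {order : ℕ} (F : FiniteField order) where
  open FiniteField F public
  open CommutativeRing commutativeRing public
    using (+-assoc; +-comm; +-identityˡ; +-identityʳ; -‿inverseʳ)
  open IntegerCoefficients commutativeRing public using (solve; _:=_; _:+_; _:*_; _:-_; :-_; Polynomial; :0; :1; :2)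

  two : Carrier
  two = 1# + 1#

  Even : (Carrier → Carrier) → Set
  Even f = ∀ z → f (- z) ≡ f z

  _≟_ : DecidableEquality Carrier
  x ≟ y = map′ (Injection.injective (↔⇒↣ enumeration)) (cong (Inverse.to enumeration))
      (Inverse.to enumeration x Fin.≟ Inverse.to enumeration y)

  *-vanish : ∀ c {l r} → l ≡ r → c * (l - r) ≡ 0#
  *-vanish c {l} refl = trans (cong (c *_) (-‿inverseʳ l)) (zeroʳ c)

  x-y≡0⇒x≡y : ∀ {x y} → x - y ≡ 0# → x ≡ y
  x-y≡0⇒x≡y {x} {y} x-y≡0 = trans (solve 2 (λ x y → x := (x :- y) :+ y) refl x y)
                                   (trans (cong (_+ y) x-y≡0) (+-identityˡ y))

  x≢y⇒x-y≢0 : ∀ {x y} → x ≢ y → x - y ≢ 0#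
  x≢y⇒x-y≢0 x≢y x-y≡0 = x≢y (x-y≡0⇒x≡y x-y≡0)

  -- Certificates: an equation follows from others once its difference is written as a combination
  -- of theirs. The combination is a polynomial identity left to the ring solver; only the
  -- multipliers have to be found.
  linear₁ : ∀ {x y} c {l r} → x - y ≡ c * (l - r) → l ≡ r → x ≡ y
  linear₁ c certificate l≡r = x-y≡0⇒x≡y (trans certificate (*-vanish c l≡r))

  linear₂ : ∀ {x y} c {l r} d {l′ r′} → x - y ≡ c * (l - r) + d * (l′ - r′) →
            l ≡ r → l′ ≡ r′ → x ≡ y
  linear₂ c d certificate l≡r l′≡r′ = x-y≡0⇒x≡y
    (trans certificate (trans (cong₂ _+_ (*-vanish c l≡r) (*-vanish d l′≡r′)) (+-identityˡ 0#)))

  linear₃ : ∀ {x y} c {l r} d {l′ r′} e {l″ r″} →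
            x - y ≡ c * (l - r) + d * (l′ - r′) + e * (l″ - r″) →
            l ≡ r → l′ ≡ r′ → l″ ≡ r″ → x ≡ y
  linear₃ c d e certificate l≡r l′≡r′ l″≡r″ = x-y≡0⇒x≡y
    (trans certificate (trans (cong₂ _+_ (trans (cong₂ _+_ (*-vanish c l≡r) (*-vanish d l′≡r′)) (+-identityˡ 0#))
                                         (*-vanish e l″≡r″)) (+-identityˡ 0#)))

  linear₄ : ∀ {x y} c {l r} d {l′ r′} e {l″ r″} g {l‴ r‴} →
            x - y ≡ c * (l - r) + d * (l′ - r′) + e * (l″ - r″) + g * (l‴ - r‴) →
            l ≡ r → l′ ≡ r′ → l″ ≡ r″ → l‴ ≡ r‴ → x ≡ y
  linear₄ c d e g certificate l≡r l′≡r′ l″≡r″ l‴≡r‴ = linear₃ c d e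
    (trans certificate (trans (cong₂ _+_ refl (*-vanish g l‴≡r‴)) (+-identityʳ _))) l≡r l′≡r′ l″≡r″

  integral : ∀ {x y} → x * y ≡ 0# → x ≢ 0# → y ≡ 0#
  integral {x} {y} xy≡0 x≢0 with inverse x x≢0
  ... | z , xz≡1 = linear₂ z y
    (solve 3 (λ x y z → y :- :0 := z :* (x :* y :- :0) :+ y :* (:1 :- x :* z)) refl x y z)
    xy≡0 (sym xz≡1)

  *-≢0 : ∀ {x y} → x ≢ 0# → y ≢ 0# → x * y ≢ 0#
  *-≢0 x≢0 y≢0 xy≡0 = y≢0 (integral xy≡0 x≢0)

  *-cancelˡ : ∀ c {x y} → c ≢ 0# → c * x ≡ c * y → x ≡ y
  *-cancelˡ c {x} {y} c≢0 cx≡cy = x-y≡0⇒x≡y (integral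
    (trans (solve 3 (λ c x y → c :* (x :- y) := c :* x :- c :* y) refl c x y)
           (trans (cong (_- (c * y)) cx≡cy) (-‿inverseʳ _))) c≢0)

-- Parity of involutions, and binomial coefficients modulo a prime

module _ where
  open CommutativeMonoidSum ℕ.+-0-commutativeMonoid using (sum; sum-cong-≗; ∑-distrib-+; sum-permute)

  private
    sum-ones : ∀ n → sum {n} (λ _ → 1) ≡ n
    sum-ones zero    = refl
    sum-ones (suc n) = cong suc (sum-ones n)

  -- Each orbit of size two contributes one ascent i < π i and one descent.
  involution-odd : ∀ {n} (π : Fin n → Fin n) → (∀ i → π (π i) ≡ i) →
                   (i₀ : Fin n) → π i₀ ≡ i₀ → (∀ i → π i ≡ i → i ≡ i₀) →
                   ∃[ k ] n ≡ k ℕ.+ k ℕ.+ 1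
  involution-odd {n} π inv i₀ fix unique = sum up , (begin
    n                                       ≡⟨ sum-ones n ⟨
    sum {n} (λ _ → 1)                       ≡⟨ sum-cong-≗ count ⟩
    sum (λ i → up i ℕ.+ up (π i) ℕ.+ eq i)  ≡⟨ ∑-distrib-+ (λ i → up i ℕ.+ up (π i)) eq ⟩
    sum (λ i → up i ℕ.+ up (π i)) ℕ.+ sum eq
      ≡⟨ cong₂ ℕ._+_ (∑-distrib-+ up (up ∘ π)) (trans (sum-single ℕ.+-0-commutativeMonoid eq i₀ eq-≢) eq-i₀) ⟩
    sum up ℕ.+ sum (up ∘ π) ℕ.+ 1           ≡⟨ cong (λ s → sum up ℕ.+ s ℕ.+ 1)
        (sum-permute up (mk↔ₛ′ π π inv inv)) ⟨
    sum up ℕ.+ sum up ℕ.+ 1                 ∎)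
    where
    open ≡-Reasoning

    up eq : Fin n → ℕ
    up i with i Fin.<? π i
    ... | yes _ = 1
    ... | no  _ = 0
    eq i with i Fin.≟ π i
    ... | yes _ = 1
    ... | no  _ = 0

    up-yes : ∀ {i} → i Fin.< π i → up i ≡ 1
    up-yes {i} i<π with i Fin.<? π i
    ... | yes _   = refl
    ... | no  i≮π = ⊥-elim (i≮π i<π)

    up-no : ∀ {i} → ¬ i Fin.< π i → up i ≡ 0
    up-no {i} i≮π with i Fin.<? π i
    ... | yes i<π = ⊥-elim (i≮π i<π)
    ... | no  _   = refl

    eq-no : ∀ {i} → i ≢ π i → eq i ≡ 0
    eq-no {i} i≢π with i Fin.≟ π i
    ... | yes i≡π = ⊥-elim (i≢π i≡π)
    ... | no  _   = refl

    eq-yes : ∀ {i} → i ≡ π i → eq i ≡ 1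
    eq-yes {i} i≡π with i Fin.≟ π i
    ... | yes _   = refl
    ... | no  i≢π = ⊥-elim (i≢π i≡π)

    eq-i₀ : eq i₀ ≡ 1
    eq-i₀ = eq-yes (sym fix)

    eq-≢ : ∀ j → j ≢ i₀ → eq j ≡ 0
    eq-≢ j j≢i₀ = eq-no λ j≡π → j≢i₀ (unique j (sym j≡π))

    -- Trichotomy of `i` and `π i`: a descent at `i` is counted by `up (π i)`, because
    -- `π (π i) ≡ i`.
    count : ∀ i → 1 ≡ up i ℕ.+ up (π i) ℕ.+ eq i
    count i with Fin.<-cmp i (π i)
    ... | tri< i<π i≢π i≯π = sym (cong₂ ℕ._+_ (cong₂ ℕ._+_ (up-yes i<π)
        (up-no (i≯π ∘ subst (π i Fin.<_) (inv i)))) (eq-no i≢π))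
    ... | tri≈ i≮π i≡π i≯π = sym (cong₂ ℕ._+_ (cong₂ ℕ._+_ (up-no i≮π)
        (up-no (i≯π ∘ subst (π i Fin.<_) (inv i)))) (eq-yes i≡π))
    ... | tri> i≮π i≢π i>π = sym (cong₂ ℕ._+_ (cong₂ ℕ._+_ (up-no i≮π)
        (up-yes (subst (π i Fin.<_) (sym (inv i)) i>π))) (eq-no i≢π))

private
  prime∤! : ∀ {p} → Prime p → ∀ k → k ℕ.< p → p ∤ k ℕ.!
  prime∤! p-prime zero    _   p∣1 = ¬prime[1] (subst Prime (∣1⇒≡1 p∣1) p-prime)
  prime∤! p-prime (suc k) k<p p∣  =
    [ (λ p∣k → ℕ.<⇒≱ k<p (∣⇒≤ p∣k))
    , prime∤! p-prime k (ℕ.<-trans (ℕ.n<1+n k) k<p)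
    ]′ (euclidsLemma (suc k) (k ℕ.!) p-prime p∣)

-- The prime divides (suc r)!, the product of the coefficient with two factorials of smaller
-- numbers, and it divides neither factorial. The index `suc k` and the bound on `k` leave out the
-- two end coefficients.
prime∣C : ∀ {r} → Prime (suc r) → ∀ k → k ℕ.< r → suc r ∣ suc r C suc k
prime∣C {r} p-prime k k<r = [ (λ p∣C → p∣C) , (λ p∣d → ⊥-elim
    ([ prime∤! p-prime (suc k) (ℕ.s≤s k<r)
     , prime∤! p-prime (r ℕ.∸ k) (ℕ.s≤s (ℕ.m∸n≤m r k))
     ]′ (euclidsLemma (suc k ℕ.!) ((r ℕ.∸ k) ℕ.!) p-prime p∣d))) ]′
  (euclidsLemma (suc r C suc k) (suc k ℕ.! ℕ.* (r ℕ.∸ k) ℕ.!) p-prime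
    (subst (suc r ∣_) (sym C*k![r∸k]!) (m∣m*n (r ℕ.!))))
  where
  k≤ : suc k ℕ.≤ suc r
  k≤ = ℕ.s≤s (ℕ.<⇒≤ k<r)

  C*k![r∸k]! : (suc r C suc k) ℕ.* (suc k ℕ.! ℕ.* (r ℕ.∸ k) ℕ.!) ≡ suc r ℕ.!
  C*k![r∸k]! = trans (cong (ℕ._* (suc k ℕ.! ℕ.* (r ℕ.∸ k) ℕ.!)) (nCk≡n!/k![n-k]! k≤)) (ℕ.m/n*n≡m (k![n∸k]!∣n! k≤))
    where instance _ = suc k ℕ.!* (r ℕ.∸ k) !≢0

-- Fermat and Frobenius in finite fields

module FiniteFieldProperties {order : ℕ} (F : FiniteField order) where
  open FieldProperties F
  open CommutativeRing commutativeRing using (+-commutativeMonoid; *-commutativeMonoid)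
  open SemiringExp semiring using (^-homo-*; ^-assocʳ)
  open CommutativeSemiringExp commutativeSemiring using (^-distrib-*)
  open SemiringMult semiring using (×1-homo-*) renaming (_×_ to _⋆_)
  open Inverse enumeration using (strictlyInverseˡ; strictlyInverseʳ) renaming (to to index; from to element)
  private
    module Sum = CommutativeMonoidSum +-commutativeMonoid
    module Product = CommutativeMonoidSum *-commutativeMonoid
  open ≡-Reasoning

  private
    reindex : (φ : Carrier ↔ Carrier) → Fin order ↔ Fin order
    reindex φ = mk↔ₛ′ (index ∘ φ.to ∘ element) (index ∘ φ.from ∘ element)
      (λ i → trans (cong (index ∘ φ.to) (strictlyInverseʳ _))
          (trans (cong index (φ.strictlyInverseˡ _)) (strictlyInverseˡ i)))
      (λ i → trans (cong (index ∘ φ.from) (strictlyInverseʳ _))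
          (trans (cong index (φ.strictlyInverseʳ _)) (strictlyInverseˡ i)))
      where module φ = Inverse φ

    shift : Carrier ↔ Carrier
    shift = mk↔ₛ′ (_+ 1#) (_- 1#)
      (solve 1 (λ x → (x :- :1) :+ :1 := x) refl)
      (solve 1 (λ x → (x :+ :1) :- :1 := x) refl)

    scale : ∀ {c d} → c * d ≡ 1# → Carrier ↔ Carrier
    scale {c} {d} cd≡1 = mk↔ₛ′ (c *_) (d *_) (cancel cd≡1) (cancel (trans (*-comm d c) cd≡1))
      where
      cancel : ∀ {c d} → c * d ≡ 1# → ∀ x → c * (d * x) ≡ x
      cancel {c} {d} cd≡1 x = trans (sym (*-assoc c d x)) (trans (cong (_* x) cd≡1) (*-identityˡ x))

  -- Translation by `1#` permutes the field, so the sum of all elements does not change when `1#` is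
  -- added to each of them.
  order⋆1≡0 : order ⋆ 1# ≡ 0#
  order⋆1≡0 = trans (sym (Sum.sum-replicate order)) (linear₁ 1#
    (solve 2 (λ s t → s :- :0 := :1 :* ((t :+ s) :- t)) refl _ (Sum.sum element))
    (begin
      Sum.sum element + Sum.sum {order} (λ _ → 1#)     ≡⟨ Sum.∑-distrib-+ element (λ _ → 1#) ⟨
      Sum.sum (λ i → element i + 1#)           ≡⟨ Sum.sum-cong-≗ {order} (λ i → strictlyInverseʳ (element i + 1#)) ⟨
      Sum.sum (element ∘ Inverse.to (reindex shift)) ≡⟨ Sum.sum-permute element (reindex shift) ⟨
      Sum.sum element                          ∎))

  private
    if-zero : Carrier → Carrier → Carrier → Carrier
    if-zero y a b with y ≟ 0#
    ... | yes _ = a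
    ... | no  _ = b

    if-zero-yes : ∀ {y a b} → y ≡ 0# → if-zero y a b ≡ a
    if-zero-yes {y} y≡0 with y ≟ 0#
    ... | yes _   = refl
    ... | no  y≢0 = ⊥-elim (y≢0 y≡0)

    if-zero-no : ∀ {y a b} → y ≢ 0# → if-zero y a b ≡ b
    if-zero-no {y} y≢0 with y ≟ 0#
    ... | yes y≡0 = ⊥-elim (y≢0 y≡0)
    ... | no  _   = refl

    product≢0 : ∀ {n} (f : Fin n → Carrier) → (∀ i → f i ≢ 0#) → Product.sum f ≢ 0#
    product≢0 {zero}  f f≢0 = 1≢0
    product≢0 {suc n} f f≢0 = *-≢0 (f≢0 zero) (product≢0 (f ∘ suc) (f≢0 ∘ suc))

  -- Multiplication by x ≢ 0# permutes the nonzero elements, so the product of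
  -- the x over all nonzero y is 1#; the factor missing at y ≡ 0# is x.
  x^order≡x : ∀ x → x ^ order ≡ x
  x^order≡x x with x ≟ 0#
  ... | yes refl = zero^ (index 0#)
    where
    zero^ : ∀ {n} → Fin n → 0# ^ n ≡ 0#
    zero^ {suc n} _ = zeroˡ (0# ^ n)
  ... | no  x≢0  = begin
    x ^ order                                                ≡⟨ Product.sum-replicate order ⟨
    Product.sum {order} (λ _ → x)                                    ≡⟨ Product.sum-cong-≗ split ⟩
    Product.sum (λ i → at-zero (element i) * off-zero (element i))
      ≡⟨ Product.∑-distrib-+ (at-zero ∘ element) (off-zero ∘ element) ⟩
    Product.sum (at-zero ∘ element) * Product.sum (off-zero ∘ element)
      ≡⟨ cong₂ _*_ (sum-single *-commutativeMonoid (at-zero ∘ element) (index 0#) at-nonzero) off-product ⟩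
    at-zero (element (index 0#)) * 1#                        ≡⟨ *-identityʳ _ ⟩
    at-zero (element (index 0#))                             ≡⟨ if-zero-yes (strictlyInverseʳ 0#) ⟩
    x                                                        ∎
    where
    at-zero off-zero unit : Carrier → Carrier
    at-zero  y = if-zero y x 1#
    off-zero y = if-zero y 1# x
    unit     y = if-zero y 1# y

    split : ∀ i → x ≡ at-zero (element i) * off-zero (element i)
    split i with element i ≟ 0#
    ... | yes _ = sym (*-identityʳ x)
    ... | no  _ = sym (*-identityˡ x)

    at-nonzero : ∀ j → j ≢ index 0# → at-zero (element j) ≡ 1#
    at-nonzero j j≢ = if-zero-no λ ej≡0 → j≢ (trans (sym (strictlyInverseˡ j)) (cong index ej≡0))

    unit≢0 : ∀ y → unit y ≢ 0#
    unit≢0 y with y ≟ 0#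
    ... | yes _   = 1≢0
    ... | no  y≢0 = y≢0

    unit-* : ∀ y → unit (x * y) ≡ off-zero y * unit y
    unit-* y with y ≟ 0#
    ... | yes refl = trans (if-zero-yes (zeroʳ x)) (sym (*-identityˡ 1#))
    ... | no  y≢0  = if-zero-no (*-≢0 x≢0 y≢0)

    permutation : Fin order ↔ Fin order
    permutation = reindex (scale (proj₂ (inverse x x≢0)))

    off-product : Product.sum (off-zero ∘ element) ≡ 1#
    off-product = *-cancelˡ (Product.sum (unit ∘ element)) (product≢0 (unit ∘ element) (unit≢0 ∘ element)) (begin
      Product.sum (unit ∘ element) * Product.sum (off-zero ∘ element)  ≡⟨ *-comm _ _ ⟩
      Product.sum (off-zero ∘ element) * Product.sum (unit ∘ element)
        ≡⟨ Product.∑-distrib-+ (off-zero ∘ element) (unit ∘ element) ⟨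
      Product.sum (λ i → off-zero (element i) * unit (element i))      ≡⟨ Product.sum-cong-≗ (unit-* ∘ element) ⟨
      Product.sum (λ i → unit (x * element i))                         ≡⟨ Product.sum-cong-≗ {order}
          (λ i → cong unit (strictlyInverseʳ (x * element i))) ⟨
      Product.sum (unit ∘ element ∘ Inverse.to permutation)            ≡⟨ Product.sum-permute (unit ∘ element)
          permutation ⟨
      Product.sum (unit ∘ element)                                     ≡⟨ *-identityʳ _ ⟨
      Product.sum (unit ∘ element) * 1#                                ∎)

  module Characteristic (p : ℕ) (p-prime : Prime p) (k : ℕ) (order≡p^k : order ≡ p ℕ.^ k) where

    -- The k-th power of `p ⋆ 1#` is `order ⋆ 1#`, which vanishes, and a field has no zero divisors.
    p⋆1≡0 : p ⋆ 1# ≡ 0#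
    p⋆1≡0 = root k (subst (λ m → m ⋆ 1# ≡ 0#) order≡p^k order⋆1≡0)
      where
      root : ∀ k → (p ℕ.^ k) ⋆ 1# ≡ 0# → p ⋆ 1# ≡ 0#
      root zero    1≡0 = ⊥-elim (1≢0 (trans (sym (+-identityʳ 1#)) 1≡0))
      root (suc k) pp≡0 with (p ⋆ 1#) ≟ 0#
      ... | yes p≡0 = p≡0
      ... | no  p≢0 = root k (integral (trans (sym (×1-homo-* p (p ℕ.^ k))) pp≡0) p≢0)

    p∣m⇒m⋆x≡0 : ∀ {m} → p ∣ m → ∀ x → m ⋆ x ≡ 0#
    p∣m⇒m⋆x≡0 (divides d refl) x = begin
      (d ℕ.* p) ⋆ x              ≡⟨ ⋆≡⋆1* (d ℕ.* p) x ⟩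
      (d ℕ.* p) ⋆ 1# * x         ≡⟨ cong (_* x) (×1-homo-* d p) ⟩
      d ⋆ 1# * p ⋆ 1# * x        ≡⟨ cong (λ z → d ⋆ 1# * z * x) p⋆1≡0 ⟩
      d ⋆ 1# * 0# * x            ≡⟨ cong (_* x) (zeroʳ (d ⋆ 1#)) ⟩
      0# * x                     ≡⟨ zeroˡ x ⟩
      0#                         ∎
      where
      ⋆≡⋆1* : ∀ m x → m ⋆ x ≡ m ⋆ 1# * x
      ⋆≡⋆1* zero    x = sym (zeroˡ x)
      ⋆≡⋆1* (suc m) x = trans (cong (x +_) (⋆≡⋆1* m x))
        (solve 2 (λ m x → x :+ m :* x := (:1 :+ m) :* x) refl (m ⋆ 1#) x)

    -- If `1# + 1#` vanished, `m ⋆ 1#` would depend only on the parity of m, and `p ⋆ 1# ≡ 0#` would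
    -- make p even.
    two≢0 : 2 ∤ p → two ≢ 0#
    two≢0 2∤p two≡0 = 2∤p (parity p p⋆1≡0)
      where
      parity : ∀ m → m ⋆ 1# ≡ 0# → 2 ∣ m
      parity zero          _   = divides 0 refl
      parity (suc zero)    1≡0 = ⊥-elim (1≢0 (trans (sym (+-identityʳ 1#)) 1≡0))
      parity (suc (suc m)) m≡0 with parity m (trans
          (trans (sym (+-identityˡ _)) (trans (cong (_+ m ⋆ 1#) (sym two≡0)) (+-assoc 1# 1# _))) m≡0)
      ... | divides d refl = divides (suc d) refl

    private
      ^p-distrib-+ : ∀ x y → (x + y) ^ p ≡ x ^ p + y ^ p
      ^p-distrib-+ x y = binomial-ends p p-prime (λ c → p∣m⇒m⋆x≡0 c)
        where
        -- The prime is generalised, along with the vanishing of its multiples, so that it can be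
        -- split into `suc r`; the fixed module parameter cannot.
        binomial-ends : ∀ p → Prime p → (∀ {m} → p ∣ m → ∀ x → m ⋆ x ≡ 0#) → (x + y) ^ p ≡ x ^ p + y ^ p
        binomial-ends zero    0-prime _      = ⊥-elim (¬prime[0] 0-prime)
        binomial-ends (suc r) p-prime vanish = begin
          (x + y) ^ suc r             ≡⟨ Binomial.theorem commutativeSemiring (suc r) x y ⟩
          Sum.sum term                ≡⟨ cong (term zero +_) (Sum.sum-init-last (term ∘ suc)) ⟩
          term zero + (Sum.sum (term ∘ suc ∘ inject₁) + term (suc (fromℕ r)))
            ≡⟨ cong₂ _+_ term-first (cong₂ _+_ (trans (Sum.sum-cong-≗ term-middle) (Sum.sum-replicate-zero r))
                term-last) ⟩
          y ^ suc r + (0# + x ^ suc r) ≡⟨ solve 2 (λ a b → b :+ (:0 :+ a) := a :+ b) refl (x ^ suc r) (y ^ suc r) ⟩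
          x ^ suc r + y ^ suc r       ∎
          where
          term : Fin (suc (suc r)) → Carrier
          term = Binomial.binomialTerm commutativeSemiring x y (suc r)

          term-first : term zero ≡ y ^ suc r
          term-first = trans (cong (_⋆ (1# * y ^ suc r)) (trans (nCk≡nC[n∸k] {0} {suc r} ℕ.z≤n) (nCn≡1 (suc r))))
            (trans (+-identityʳ _) (*-identityˡ _))

          term-middle : ∀ i → term (suc (inject₁ i)) ≡ 0#
          term-middle i = vanish (subst (λ k → suc r ∣ suc r C suc k) (sym (Fin.toℕ-inject₁ i))
              (prime∣C p-prime (toℕ i) (Fin.toℕ<n i))) _

          term-last : term (suc (fromℕ r)) ≡ x ^ suc r
          term-last = trans (cong (λ k → (suc r C suc k) ⋆ (x ^ suc k * y ^ (r ℕ.∸ k))) (Fin.toℕ-fromℕ r))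
            (trans (cong₂ (λ c k → c ⋆ (x ^ suc r * y ^ k)) (nCn≡1 (suc r)) (ℕ.n∸n≡0 r))
            (trans (+-identityʳ _) (*-identityʳ _)))

    ^p^-distrib-+ : ∀ n x y → (x + y) ^ (p ℕ.^ n) ≡ x ^ (p ℕ.^ n) + y ^ (p ℕ.^ n)
    ^p^-distrib-+ zero    x y = solve 2 (λ x y → (x :+ y) :* :1 := x :* :1 :+ y :* :1) refl x y
    ^p^-distrib-+ (suc n) x y = begin
      (x + y) ^ (p ℕ.* p ℕ.^ n)                     ≡⟨ ^-assocʳ (x + y) p (p ℕ.^ n) ⟨
      ((x + y) ^ p) ^ (p ℕ.^ n)                     ≡⟨ cong (_^ (p ℕ.^ n)) (^p-distrib-+ x y) ⟩
      (x ^ p + y ^ p) ^ (p ℕ.^ n)                   ≡⟨ ^p^-distrib-+ n (x ^ p) (y ^ p) ⟩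
      (x ^ p) ^ (p ℕ.^ n) + (y ^ p) ^ (p ℕ.^ n)     ≡⟨ cong₂ _+_ (^-assocʳ x p (p ℕ.^ n)) (^-assocʳ y p (p ℕ.^ n)) ⟩
      x ^ (p ℕ.* p ℕ.^ n) + y ^ (p ℕ.* p ℕ.^ n)     ∎

-- Hermitian forms in three variables

-- The laws of the Frobenius involution z ↦ z ^ q on which the Hermitian and circle geometry rests;
-- its fixed elements play the part of real numbers.
record IsConjugation {order : ℕ} (F : FiniteField order)
                     (_ᶜ : FiniteField.Carrier F → FiniteField.Carrier F) : Set where
  open FieldProperties F
  field
    ᶜ-+        : ∀ x y → (x + y) ᶜ ≡ x ᶜ + y ᶜ
    ᶜ-*        : ∀ x y → (x * y) ᶜ ≡ x ᶜ * y ᶜ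
    involutive : ∀ x → x ᶜ ᶜ ≡ x

  ᶜ-0 : 0# ᶜ ≡ 0#
  ᶜ-0 = linear₁ 1# (solve 1 (λ z → z :- :0 := :1 :* ((z :+ z) :- z)) refl (0# ᶜ))
    (trans (sym (ᶜ-+ 0# 0#)) (cong _ᶜ (+-identityˡ 0#)))

  -- Multiplicativity alone would allow zero; involutivity gives 1 ᶜ = 1 ᶜ ᶜ · 1 ᶜ = (1 ᶜ · 1) ᶜ =
  -- 1.
  ᶜ-1 : 1# ᶜ ≡ 1#
  ᶜ-1 = trans (sym (*-identityˡ _)) (trans (cong (_* 1# ᶜ) (sym (involutive 1#)))
    (trans (sym (ᶜ-* (1# ᶜ) 1#)) (trans (cong _ᶜ (*-identityʳ _)) (involutive 1#))))

  ᶜ-neg : ∀ x → (- x) ᶜ ≡ - (x ᶜ)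
  ᶜ-neg x = linear₂ 1# 1# (solve 3 (λ a b z → a :- (:- b) := :1 :* ((b :+ a) :- z) :+ :1 :* (z :- :0)) refl
      ((- x) ᶜ) (x ᶜ) ((x - x) ᶜ))
    (sym (ᶜ-+ x (- x))) (trans (cong _ᶜ (-‿inverseʳ x)) ᶜ-0)

  ᶜ-- : ∀ x y → (x - y) ᶜ ≡ x ᶜ - y ᶜ
  ᶜ-- x y = trans (ᶜ-+ x (- y)) (cong (x ᶜ +_) (ᶜ-neg y))

  ᶜ-two : two ᶜ ≡ two
  ᶜ-two = trans (ᶜ-+ 1# 1#) (cong₂ _+_ ᶜ-1 ᶜ-1)

  ᶜ-≢0 : ∀ {x} → x ≢ 0# → x ᶜ ≢ 0#
  ᶜ-≢0 {x} x≢0 xᶜ≡0 = x≢0 (trans (sym (involutive x)) (trans (cong _ᶜ xᶜ≡0) ᶜ-0))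

  norm-≡0 : ∀ {x} → x * x ᶜ ≡ 0# → x ≡ 0#
  norm-≡0 {x} xxᶜ≡0 with x ≟ 0#
  ... | yes x≡0 = x≡0
  ... | no  x≢0 = ⊥-elim (ᶜ-≢0 x≢0 (integral xxᶜ≡0 x≢0))

module Triples {order : ℕ} (F : FiniteField order) where
  open FieldProperties F

  private
    V = Triple F

  dot : V → V → Carrier
  dot (a , b , c) (X , Y , Z) = a * X + b * Y + c * Z

  cross : V → V → V
  cross (a , b , c) (X , Y , Z) = b * Z - c * Y , c * X - a * Z , a * Y - b * X

  triple-≡ : ∀ {x y z x′ y′ z′ : Carrier} → x ≡ x′ → y ≡ y′ → z ≡ z′ →
             _≡_ {A = V} (x , y , z) (x′ , y′ , z′)
  triple-≡ refl refl refl = refl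

  fst snd trd : ∀ {A : Set} → A × A × A → A
  fst (x , _ , _) = x
  snd (_ , y , _) = y
  trd (_ , _ , z) = z

  dot-comm : ∀ v w → dot v w ≡ dot w v
  dot-comm (a , b , c) (X , Y , Z) = solve 6 (λ a b c X Y Z → a :* X :+ b :* Y :+ c :* Z := X :* a :+ Y :* b :+ Z
      :* c) refl a b c X Y Z

  dot-scale : ∀ w k v → dot w (_·_ F k v) ≡ k * dot w v
  dot-scale (a , b , c) k (X , Y , Z) = solve 7 (λ a b c k X Y Z →
    a :* (k :* X) :+ b :* (k :* Y) :+ c :* (k :* Z) := k :* (a :* X :+ b :* Y :+ c :* Z)) refl a b c k X Y Z

  private
    module _ {n : ℕ} where
      :dot : (u v : Polynomial n × Polynomial n × Polynomial n) → Polynomial n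
      :dot (a , b , c) (X , Y , Z) = a :* X :+ b :* Y :+ c :* Z

      :cross : (u v : Polynomial n × Polynomial n × Polynomial n) → Polynomial n × Polynomial n × Polynomial n
      :cross (a , b , c) (X , Y , Z) = b :* Z :- c :* Y , c :* X :- a :* Z , a :* Y :- b :* X

  -- For `i` the coordinate along a unit vector e, this is det(v , P , Q) · det(e , p , q) as the
  -- determinant of the nine pairings, expanded along the row of v.
  GramIdentity : (V → Carrier) → Set
  GramIdentity i = ∀ v P Q p q →
    dot v (cross P Q) * i (cross p q)
      ≡ i v * (dot P p * dot Q q - dot P q * dot Q p)
      - dot v p * (i P * dot Q q - dot P q * i Q)
      + dot v q * (i P * dot Q p - dot P p * i Q)

  private
    :gram : ∀ {n} (i : Polynomial n × Polynomial n × Polynomial n → Polynomial n) → _ → _ → _ → _ → _ → _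
    :gram i v P Q p q = :dot v (:cross P Q) :* i (:cross p q)
      := i v :* (:dot P p :* :dot Q q :- :dot P q :* :dot Q p)
      :- :dot v p :* (i P :* :dot Q q :- :dot P q :* i Q)
      :+ :dot v q :* (i P :* :dot Q p :- :dot P p :* i Q)

  gram₁ : GramIdentity fst
  gram₁ (v₁ , v₂ , v₃) (P₁ , P₂ , P₃) (Q₁ , Q₂ , Q₃) (p₁ , p₂ , p₃) (q₁ , q₂ , q₃) =
    solve 15 (λ v₁ v₂ v₃ P₁ P₂ P₃ Q₁ Q₂ Q₃ p₁ p₂ p₃ q₁ q₂ q₃ →
      :gram fst (v₁ , v₂ , v₃) (P₁ , P₂ , P₃) (Q₁ , Q₂ , Q₃) (p₁ , p₂ , p₃) (q₁ , q₂ , q₃))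
      refl v₁ v₂ v₃ P₁ P₂ P₃ Q₁ Q₂ Q₃ p₁ p₂ p₃ q₁ q₂ q₃

  gram₂ : GramIdentity snd
  gram₂ (v₁ , v₂ , v₃) (P₁ , P₂ , P₃) (Q₁ , Q₂ , Q₃) (p₁ , p₂ , p₃) (q₁ , q₂ , q₃) =
    solve 15 (λ v₁ v₂ v₃ P₁ P₂ P₃ Q₁ Q₂ Q₃ p₁ p₂ p₃ q₁ q₂ q₃ →
      :gram snd (v₁ , v₂ , v₃) (P₁ , P₂ , P₃) (Q₁ , Q₂ , Q₃) (p₁ , p₂ , p₃) (q₁ , q₂ , q₃))
      refl v₁ v₂ v₃ P₁ P₂ P₃ Q₁ Q₂ Q₃ p₁ p₂ p₃ q₁ q₂ q₃

  gram₃ : GramIdentity trd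
  gram₃ (v₁ , v₂ , v₃) (P₁ , P₂ , P₃) (Q₁ , Q₂ , Q₃) (p₁ , p₂ , p₃) (q₁ , q₂ , q₃) =
    solve 15 (λ v₁ v₂ v₃ P₁ P₂ P₃ Q₁ Q₂ Q₃ p₁ p₂ p₃ q₁ q₂ q₃ →
      :gram trd (v₁ , v₂ , v₃) (P₁ , P₂ , P₃) (Q₁ , Q₂ , Q₃) (p₁ , p₂ , p₃) (q₁ , q₂ , q₃))
      refl v₁ v₂ v₃ P₁ P₂ P₃ Q₁ Q₂ Q₃ p₁ p₂ p₃ q₁ q₂ q₃

module HermitianForm {order : ℕ} {F : FiniteField order}
                     {_ᶜ : FiniteField.Carrier F → FiniteField.Carrier F}
                     (isConjugation : IsConjugation F _ᶜ) where
  open FieldProperties F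
  open IsConjugation isConjugation
  open Triples F
  open ≡-Reasoning

  infixr 7 _·ᵥ_
  infix 4 _∝_

  V = Triple F
  _·ᵥ_ : Carrier → V → V
  _·ᵥ_ = _·_ F
  _∝_ : V → V → Set
  _∝_ = Proportional F
  0ᵥ : V
  0ᵥ = 0# , 0# , 0#

  conj : V → V
  conj (X , Y , Z) = X ᶜ , Y ᶜ , Z ᶜ

  Isotropic : V → Set
  Isotropic v = dot v (conj v) ≡ 0#

  conj-dot : ∀ v w → dot v w ᶜ ≡ dot (conj v) (conj w)
  conj-dot (a , b , c) (X , Y , Z) = begin
    (a * X + b * Y + c * Z) ᶜ               ≡⟨ ᶜ-+ _ _ ⟩
    (a * X + b * Y) ᶜ + (c * Z) ᶜ           ≡⟨ cong₂ _+_ (ᶜ-+ _ _) (ᶜ-* c Z) ⟩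
    (a * X) ᶜ + (b * Y) ᶜ + c ᶜ * Z ᶜ       ≡⟨ cong (_+ c ᶜ * Z ᶜ) (cong₂ _+_ (ᶜ-* a X) (ᶜ-* b Y)) ⟩
    a ᶜ * X ᶜ + b ᶜ * Y ᶜ + c ᶜ * Z ᶜ       ∎

  conj-involutive : ∀ v → conj (conj v) ≡ v
  conj-involutive (X , Y , Z) = triple-≡ (involutive X) (involutive Y) (involutive Z)

  conj-scale : ∀ k v → conj (k ·ᵥ v) ≡ k ᶜ ·ᵥ conj v
  conj-scale k (X , Y , Z) = triple-≡ (ᶜ-* k X) (ᶜ-* k Y) (ᶜ-* k Z)

  conj-cross : ∀ v w → conj (cross v w) ≡ cross (conj v) (conj w)
  conj-cross (a , b , c) (X , Y , Z) = triple-≡ (minor b Z c Y) (minor c X a Z) (minor a Y b X)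
    where
    minor : ∀ s t u v → (s * t - u * v) ᶜ ≡ s ᶜ * t ᶜ - u ᶜ * v ᶜ
    minor s t u v = trans (ᶜ-- _ _) (cong₂ _-_ (ᶜ-* s t) (ᶜ-* u v))

  ∝-nonzero : ∀ {v w c} → w ≢ 0ᵥ → w ≡ c ·ᵥ v → v ∝ w
  ∝-nonzero {v} {w} {c} w≢0 w≡cv = c , (λ { refl → w≢0 (trans w≡cv (triple-≡ (zeroˡ _) (zeroˡ _) (zeroˡ _))) }) ,
      w≡cv

  private
    ratio : ∀ {a i s t X} → a * i ≡ 1# → a * t ≡ s * X → t ≡ X * i * s
    ratio {a} {i} {s} {t} {X} ai≡1 eq = linear₂ i (- t)
      (solve 5 (λ a i s t X → t :- X :* i :* s := i :* (a :* t :- s :* X) :+ (:- t) :* (a :* i :- :1)) refl a i s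
          t X)
      eq ai≡1

  -- All 2 × 2 minors vanish, so the quotient taken at any nonzero coordinate of v serves for all
  -- three.
  cross≡0⇒∝ : ∀ v w → v ≢ 0ᵥ → w ≢ 0ᵥ → cross v w ≡ 0ᵥ → v ∝ w
  cross≡0⇒∝ (a , b , c) (X , Y , Z) v≢0 w≢0 v×w≡0 = pivot (a ≟ 0#) (b ≟ 0#) (c ≟ 0#)
    where
    bZ : b * Z ≡ c * Y
    bZ = x-y≡0⇒x≡y (cong fst v×w≡0)
    cX : c * X ≡ a * Z
    cX = x-y≡0⇒x≡y (cong snd v×w≡0)
    aY : a * Y ≡ b * X
    aY = x-y≡0⇒x≡y (cong trd v×w≡0)

    pivot : Dec (a ≡ 0#) → Dec (b ≡ 0#) → Dec (c ≡ 0#) → (a , b , c) ∝ (X , Y , Z)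
    pivot (yes refl) (yes refl) (yes refl) = ⊥-elim (v≢0 refl)
    pivot (no a≢0) _ _ = ∝-nonzero w≢0 (triple-≡ (ratio ai refl) (ratio ai aY) (ratio ai (sym cX)))
      where ai = proj₂ (inverse a a≢0)
    pivot (yes _) (no b≢0) _ = ∝-nonzero w≢0 (triple-≡ (ratio bi (sym aY)) (ratio bi refl) (ratio bi bZ))
      where bi = proj₂ (inverse b b≢0)
    pivot (yes _) (yes _) (no c≢0) = ∝-nonzero w≢0 (triple-≡ (ratio ci cX) (ratio ci (sym bZ)) (ratio ci refl))
      where ci = proj₂ (inverse c c≢0)

  -- Otherwise the Gram identities with v a unit vector would make every
  -- component of cross P Q have norm zero.
  isotropic-pairing≢0 : ∀ P Q → P ≢ 0ᵥ → Q ≢ 0ᵥ → Isotropic P → Isotropic Q → ¬ P ∝ Q → dot P (conj Q) ≢ 0#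
  isotropic-pairing≢0 P Q P≢0 Q≢0 PP QQ P∝̸Q PQ = P∝̸Q (cross≡0⇒∝ P Q P≢0 Q≢0 (triple-≡
    (norm-≡0 (trans (cong₂ _*_ (solve 3 (λ x y z → x := :1 :* x :+ :0 :* y :+ :0 :* z) refl _ _ _)
        (cong fst (conj-cross P Q))) (collapse (gram₁ _ P Q p q))))
    (norm-≡0 (trans (cong₂ _*_ (solve 3 (λ x y z → y := :0 :* x :+ :1 :* y :+ :0 :* z) refl _ _ _)
        (cong snd (conj-cross P Q))) (collapse (gram₂ _ P Q p q))))
    (norm-≡0 (trans (cong₂ _*_ (solve 3 (λ x y z → z := :0 :* x :+ :0 :* y :+ :1 :* z) refl _ _ _)
        (cong trd (conj-cross P Q))) (collapse (gram₃ _ P Q p q))))))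
    where
    p = conj P
    q = conj Q

    QP : dot Q p ≡ 0#
    QP = begin
      dot Q p             ≡⟨ dot-comm Q p ⟩
      dot p Q             ≡⟨ cong (dot p) (conj-involutive Q) ⟨
      dot p (conj q)      ≡⟨ conj-dot P q ⟨
      dot P q ᶜ           ≡⟨ cong _ᶜ PQ ⟩
      0# ᶜ                ≡⟨ ᶜ-0 ⟩
      0#                  ∎

    collapse : ∀ {l x y z s t} → l ≡ x * (dot P p * dot Q q - dot P q * dot Q p)
                                   - y * (s * dot Q q - dot P q * t) + z * (s * dot Q p - dot P p * t) → l ≡ 0#
    collapse {l} {x} {y} {z} {s} {t} eq rewrite PP | QQ | PQ | QP = trans eq
      (solve 5 (λ x y z s t → x :* (:0 :* :0 :- :0 :* :0) :- y :* (s :* :0 :- :0 :* t) :+ z :*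
          (s :* :0 :- :0 :* t) := :0) refl x y z s t)

  module Frame (P Q : V) (PP : Isotropic P) (QQ : Isotropic Q) (PQ : dot P (conj Q) ≡ 1#) where
    -- A vector orthogonal to P and Q for the Hermitian form: its conjugate is `cross P Q`.
    R : V
    R = cross (conj P) (conj Q)

    -- The coefficients of P, Q and R. In a hyperbolic pair the coefficient of one vector is the
    -- pairing with the other; the sign of `C` comes from ⟨R , R⟩ ≡ - 1.
    A B C : V → Carrier
    A v = dot v (conj Q)
    B v = dot v (conj P)
    C v = - dot v (cross P Q)

    private
      p = conj P
      q = conj Q

    QP : dot Q p ≡ 1#
    QP = begin
      dot Q p             ≡⟨ dot-comm Q p ⟩
      dot p Q             ≡⟨ cong (dot p) (conj-involutive Q) ⟨
      dot p (conj q)      ≡⟨ conj-dot P q ⟨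
      dot P q ᶜ           ≡⟨ cong _ᶜ PQ ⟩
      1# ᶜ                ≡⟨ ᶜ-1 ⟩
      1#                  ∎

    combination : Carrier → Carrier → Carrier → V
    combination a b c = a * fst P + b * fst Q + c * fst R , a * snd P + b * snd Q + c * snd R , a * trd P + b *
        trd Q + c * trd R

    -- With the pairings 0, 0, 1, 1 of the hyperbolic pair inserted, each Gram identity becomes
    -- Cramer's rule for one component of v.
    expansion : ∀ v → v ≡ combination (A v) (B v) (C v)
    expansion v = triple-≡ (normalise (gram₁ v P Q p q)) (normalise (gram₂ v P Q p q)) (normalise (gram₃ v P Q p q))
      where
      normalise : ∀ {g r x y z s t} → g * r ≡ x * (dot P p * dot Q q - dot P q * dot Q p)
                    - y * (s * dot Q q - dot P q * t) + z * (s * dot Q p - dot P p * t) →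
                  x ≡ z * s + y * t + - g * r
      normalise {g} {r} {x} {y} {z} {s} {t} eq rewrite PP | QQ | PQ | QP = linear₁ 1#
        (solve 7 (λ g r x y z s t → x :- (z :* s :+ y :* t :+ (:- g) :* r) := :1 :*
          (g :* r :- (x :* (:0 :* :0 :- :1 :* :1) :- y :* (s :* :0 :- :1 :* t) :+ z :*
              (s :* :1 :- :0 :* t)))) refl g r x y z s t) eq

    dot-combination : ∀ w a b c → dot w (combination a b c) ≡ a * dot w P + b * dot w Q + c * dot w R
    dot-combination (w₁ , w₂ , w₃) a b c = lemma w₁ w₂ w₃ a b c (fst P) (snd P) (trd P) (fst Q) (snd Q) (trd Q)
        (fst R) (snd R) (trd R)
      where
      lemma = solve 15 (λ w₁ w₂ w₃ a b c P₁ P₂ P₃ Q₁ Q₂ Q₃ R₁ R₂ R₃ →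
        w₁ :* (a :* P₁ :+ b :* Q₁ :+ c :* R₁) :+ w₂ :* (a :* P₂ :+ b :* Q₂ :+ c :* R₂) :+ w₃ :*
            (a :* P₃ :+ b :* Q₃ :+ c :* R₃)
        := a :* (w₁ :* P₁ :+ w₂ :* P₂ :+ w₃ :* P₃) :+ b :* (w₁ :* Q₁ :+ w₂ :* Q₂ :+ w₃ :* Q₃) :+ c :*
            (w₁ :* R₁ :+ w₂ :* R₂ :+ w₃ :* R₃)) refl

    dot-expansion : ∀ w v → dot w v ≡ A v * dot w P + B v * dot w Q + C v * dot w R
    dot-expansion w v = trans (cong (dot w) (expansion v)) (dot-combination w (A v) (B v) (C v))

    cross-orthogonal : ∀ P Q → dot P (cross P Q) ≡ 0#
    cross-orthogonal (P₁ , P₂ , P₃) (Q₁ , Q₂ , Q₃) = solve 6 (λ P₁ P₂ P₃ Q₁ Q₂ Q₃ →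
      P₁ :* (P₂ :* Q₃ :- P₃ :* Q₂) :+ P₂ :* (P₃ :* Q₁ :- P₁ :* Q₃) :+ P₃ :* (P₁ :* Q₂ :- P₂ :* Q₁) :=
          :0) refl P₁ P₂ P₃ Q₁ Q₂ Q₃

    cross-orthogonal′ : ∀ P Q → dot Q (cross P Q) ≡ 0#
    cross-orthogonal′ (P₁ , P₂ , P₃) (Q₁ , Q₂ , Q₃) = solve 6 (λ P₁ P₂ P₃ Q₁ Q₂ Q₃ →
      Q₁ :* (P₂ :* Q₃ :- P₃ :* Q₂) :+ Q₂ :* (P₃ :* Q₁ :- P₁ :* Q₃) :+ Q₃ :* (P₁ :* Q₂ :- P₂ :* Q₁) :=
          :0) refl P₁ P₂ P₃ Q₁ Q₂ Q₃

    dot-cross-cross : ∀ P Q p q → dot (cross P Q) (cross p q) ≡ dot P p * dot Q q - dot P q * dot Q p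
    dot-cross-cross (P₁ , P₂ , P₃) (Q₁ , Q₂ , Q₃) (p₁ , p₂ , p₃) (q₁ , q₂ , q₃) = solve 12
        (λ P₁ P₂ P₃ Q₁ Q₂ Q₃ p₁ p₂ p₃ q₁ q₂ q₃ →
      (P₂ :* Q₃ :- P₃ :* Q₂) :* (p₂ :* q₃ :- p₃ :* q₂) :+ (P₃ :* Q₁ :- P₁ :* Q₃) :* (p₃ :* q₁ :- p₁ :* q₃) :+
          (P₁ :* Q₂ :- P₂ :* Q₁) :* (p₁ :* q₂ :- p₂ :* q₁)
      := (P₁ :* p₁ :+ P₂ :* p₂ :+ P₃ :* p₃) :* (Q₁ :* q₁ :+ Q₂ :* q₂ :+ Q₃ :* q₃) :-
          (P₁ :* q₁ :+ P₂ :* q₂ :+ P₃ :* q₃) :* (Q₁ :* p₁ :+ Q₂ :* p₂ :+ Q₃ :* p₃))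
      refl P₁ P₂ P₃ Q₁ Q₂ Q₃ p₁ p₂ p₃ q₁ q₂ q₃

    coordinate : ∀ w {x y z} → dot P w ≡ x → dot Q w ≡ y → dot R w ≡ z → ∀ a b c →
                 dot (combination a b c) w ≡ a * x + b * y + c * z
    coordinate w refl refl refl a b c = trans (dot-comm _ w) (trans (dot-combination w a b c)
      (cong₂ _+_ (cong₂ _+_ (cong (a *_) (dot-comm w P)) (cong (b *_) (dot-comm w Q)))
          (cong (c *_) (dot-comm w R))))

    A-combination : ∀ a b c → A (combination a b c) ≡ a
    A-combination a b c = trans (coordinate q PQ QQ (trans (dot-comm R q) (cross-orthogonal′ p q)) a b c)
      (solve 3 (λ a b c → a :* :1 :+ b :* :0 :+ c :* :0 := a) refl a b c)

    B-combination : ∀ a b c → B (combination a b c) ≡ b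
    B-combination a b c = trans (coordinate p PP QP (trans (dot-comm R p) (cross-orthogonal p q)) a b c)
      (solve 3 (λ a b c → a :* :0 :+ b :* :1 :+ c :* :0 := b) refl a b c)

    C-combination : ∀ a b c → C (combination a b c) ≡ c
    C-combination a b c = trans (cong -_ (coordinate (cross P Q) (cross-orthogonal P Q) (cross-orthogonal′ P Q)
        RR a b c))
      (solve 3 (λ a b c → :- (a :* :0 :+ b :* :0 :+ c :* (:0 :* :0 :- :1 :* :1)) := c) refl a b c)
      where
      RR : dot R (cross P Q) ≡ 0# * 0# - 1# * 1#
      RR = trans (dot-comm R _) (trans (dot-cross-cross P Q p q) (cong₂ _-_ (cong₂ _*_ PP QQ) (cong₂ _*_ PQ QP)))

    norm-expansion : ∀ v → dot v (conj v) ≡ A v * (B v) ᶜ + B v * (A v) ᶜ - C v * (C v) ᶜ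
    norm-expansion v = begin
      dot v (conj v)                                          ≡⟨ dot-comm v (conj v) ⟩
      dot (conj v) v                                          ≡⟨ dot-expansion (conj v) v ⟩
      A v * dot (conj v) P + B v * dot (conj v) Q + C v * dot (conj v) R
        ≡⟨ cong₂ _+_ (cong₂ _+_ (cong (A v *_) (pairing P)) (cong (B v *_) (pairing Q))) (cong (C v *_) pairing-R) ⟩
      A v * (B v) ᶜ + B v * (A v) ᶜ + C v * - ((C v) ᶜ)
        ≡⟨ solve 3 (λ s c d → s :+ c :* (:- d) := s :- c :* d) refl (A v * (B v) ᶜ + B v * (A v) ᶜ) (C v)
            ((C v) ᶜ) ⟩
      A v * (B v) ᶜ + B v * (A v) ᶜ - C v * (C v) ᶜ           ∎
      where
      pairing : ∀ w → dot (conj v) w ≡ dot v (conj w) ᶜ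
      pairing w = trans (cong (dot (conj v)) (sym (conj-involutive w))) (sym (conj-dot v (conj w)))

      pairing-R : dot (conj v) R ≡ - ((C v) ᶜ)
      pairing-R = begin
        dot (conj v) R                     ≡⟨ cong (dot (conj v)) (conj-cross P Q) ⟨
        dot (conj v) (conj (cross P Q))    ≡⟨ conj-dot v (cross P Q) ⟨
        dot v (cross P Q) ᶜ                ≡⟨ solve 1 (λ x → x := :- (:- x)) refl _ ⟩
        - (- (dot v (cross P Q) ᶜ))        ≡⟨ cong -_ (ᶜ-neg _) ⟨
        - ((C v) ᶜ)                        ∎

    -- `B v ≡ 0#` is the tangent at P. On it the form reduces to - C C ᶜ, so an isotropic vector
    -- there has C ≡ 0 and is a multiple of P.
    isotropic-B≢0 : ∀ {v} → v ≢ 0ᵥ → Isotropic v → ¬ P ∝ v → B v ≢ 0#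
    isotropic-B≢0 {v} v≢0 vv P∝̸v B≡0 = P∝̸v (∝-nonzero v≢0 (begin
      v                                    ≡⟨ expansion v ⟩
      combination (A v) (B v) (C v)        ≡⟨ cong₂ (combination (A v)) B≡0 C≡0 ⟩
      combination (A v) 0# 0#              ≡⟨ triple-≡ (drop _ _ _) (drop _ _ _) (drop _ _ _) ⟩
      A v ·ᵥ P                             ∎))
      where
      C≡0 : C v ≡ 0#
      C≡0 = norm-≡0 (lemma (B v) B≡0 (trans (sym vv) (norm-expansion v)))
        where
        lemma : ∀ b {a a′ c} → b ≡ 0# → 0# ≡ a * b ᶜ + b * a′ - c → c ≡ 0#
        lemma b {a} {a′} {c} refl eq rewrite ᶜ-0 = linear₁ 1#
            (solve 3 (λ a a′ c → c :- :0 := :1 :* (:0 :- (a :* :0 :+ :0 :* a′ :- c))) refl a a′ c) eq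

      drop : ∀ x y z → A v * x + 0# * y + 0# * z ≡ A v * x
      drop = solve 4 (λ a x y z → a :* x :+ :0 :* y :+ :0 :* z := a :* x) refl (A v)

    B-P : B P ≡ 0#
    B-P = PP

-- Linear algebra over the fixed field of the conjugation

module FixedFieldGeometry {order : ℕ} {F : FiniteField order}
                     {_ᶜ : FiniteField.Carrier F → FiniteField.Carrier F}
                     (isConjugation : IsConjugation F _ᶜ) where
  open FieldProperties F
  open IsConjugation isConjugation

  -- Vanishes exactly when X and Y are dependent over the fixed field of _ᶜ.
  det : Carrier → Carrier → Carrier
  det X Y = X * Y ᶜ - X ᶜ * Y

  det-self : ∀ X → det X X ≡ 0#
  det-self X = solve 2 (λ X X′ → X :* X′ :- X′ :* X := :0) refl X (X ᶜ)

  det≢0⇒≢0ˡ : ∀ {X Y} → det X Y ≢ 0# → X ≢ 0#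
  det≢0⇒≢0ˡ {Y = Y} det≢0 refl = det≢0 (trans (cong (λ z → 0# * Y ᶜ - z * Y) ᶜ-0)
    (solve 2 (λ Y Y′ → :0 :* Y′ :- :0 :* Y := :0) refl Y (Y ᶜ)))

  det-≡0ˡ : ∀ {X} Y → X ≡ 0# → det X Y ≡ 0#
  det-≡0ˡ Y refl = trans (cong (λ z → 0# * Y ᶜ - z * Y) ᶜ-0)
    (solve 2 (λ Y Y′ → :0 :* Y′ :- :0 :* Y := :0) refl Y (Y ᶜ))

  det-≡0ʳ : ∀ X {Y} → Y ≡ 0# → det X Y ≡ 0#
  det-≡0ʳ X refl = trans (cong (λ z → X * z - X ᶜ * 0#) ᶜ-0)
    (solve 2 (λ X X′ → X :* :0 :- X′ :* :0 := :0) refl X (X ᶜ))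

  inverse-fixed : ∀ {s i} → s ᶜ ≡ s → s * i ≡ 1# → i ᶜ ≡ i
  inverse-fixed {s} {i} sᶜ≡s si≡1 = linear₂ (i ᶜ) (- i)
    (solve 3 (λ s i i′ → i′ :- i := i′ :* (:1 :- s :* i) :+ (:- i) :* (:1 :- s :* i′)) refl s i (i ᶜ))
    (sym si≡1) (sym (trans (cong (_* i ᶜ) (sym sᶜ≡s)) (trans (sym (ᶜ-* s i)) (trans (cong _ᶜ si≡1) ᶜ-1))))

  -- Cramer's rule with k and k ᶜ treated as independent unknowns. Conjugation negates the
  -- determinant, which makes the second unknown the conjugate of the first.
  solve-trace : ∀ X Z {e e′} → e ᶜ ≡ e → e′ ᶜ ≡ e′ → det X Z ≢ 0# →
                ∃[ k ] (k * X + k ᶜ * X ᶜ ≡ e × k * Z + k ᶜ * Z ᶜ ≡ e′)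
  solve-trace X Z {e} {e′} eᶜ≡e e′ᶜ≡e′ det≢0 with inverse (det X Z) det≢0
  ... | i , Di≡1 = (e * Z ᶜ - e′ * X ᶜ) * i
    , linear₂ (X ᶜ) e (solve 8 (λ X X′ Z Z′ e e′ i k′ →
        (e :* Z′ :- e′ :* X′) :* i :* X :+ k′ :* X′ :- e
        := X′ :* (k′ :- (e :* Z :- e′ :* X) :* (:- i)) :+ e :* ((X :* Z′ :- X′ :* Z) :* i :- :1))
        refl X (X ᶜ) Z (Z ᶜ) e e′ i _) k-conj Di≡1
    , linear₂ (Z ᶜ) e′ (solve 8 (λ X X′ Z Z′ e e′ i k′ →
        (e :* Z′ :- e′ :* X′) :* i :* Z :+ k′ :* Z′ :- e′
        := Z′ :* (k′ :- (e :* Z :- e′ :* X) :* (:- i)) :+ e′ :* ((X :* Z′ :- X′ :* Z) :* i :- :1))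
        refl X (X ᶜ) Z (Z ᶜ) e e′ i _) k-conj Di≡1
    where
    det-conj : (det X Z) ᶜ ≡ - det X Z
    det-conj = trans (trans (ᶜ-- _ _) (cong₂ _-_ (trans (ᶜ-* _ _) (cong (X ᶜ *_) (involutive Z)))
        (trans (ᶜ-* _ _) (cong (_* Z ᶜ) (involutive X)))))
      (solve 4 (λ X X′ Z Z′ → X′ :* Z :- X :* Z′ := :- (X :* Z′ :- X′ :* Z)) refl X (X ᶜ) Z (Z ᶜ))

    i-conj : i ᶜ ≡ - i
    i-conj = linear₂ (- i) (- (i ᶜ)) (solve 3 (λ D i i′ → i′ :- (:- i) := (:- i) :* ((:- D) :* i′ :- :1) :+
        (:- i′) :* (D :* i :- :1)) refl (det X Z) i (i ᶜ))
      (trans (cong (_* i ᶜ) (sym det-conj)) (trans (sym (ᶜ-* (det X Z) i)) (trans (cong _ᶜ Di≡1) ᶜ-1))) Di≡1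

    k-conj : ((e * Z ᶜ - e′ * X ᶜ) * i) ᶜ ≡ (e * Z - e′ * X) * (- i)
    k-conj = trans (ᶜ-* _ i) (cong₂ _*_ (trans (ᶜ-- _ _) (cong₂ _-_
      (trans (ᶜ-* e (Z ᶜ)) (cong₂ _*_ eᶜ≡e (involutive Z)))
      (trans (ᶜ-* e′ (X ᶜ)) (cong₂ _*_ e′ᶜ≡e′ (involutive X))))) i-conj)

  trace-unique : ∀ X Z {c} → det X Z ≢ 0# → c * X + c ᶜ * X ᶜ ≡ 0# → c * Z + c ᶜ * Z ᶜ ≡ 0# → c ≡ 0#
  trace-unique X Z {c} det≢0 cX cZ = integral {det X Z} (linear₂ (Z ᶜ) (- (X ᶜ))
    (solve 6 (λ X X′ Z Z′ c c′ → (X :* Z′ :- X′ :* Z) :* c :- :0 :=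
      Z′ :* ((c :* X :+ c′ :* X′) :- :0) :+ (:- X′) :* ((c :* Z :+ c′ :* Z′) :- :0)) refl X (X ᶜ) Z (Z ᶜ) c (c
          ᶜ)) cX cZ) det≢0

  dependent⇒multiple : ∀ {X Z} → X ≢ 0# → det X Z ≡ 0# → ∃[ l ] (l ᶜ ≡ l × Z ≡ l * X)
  dependent⇒multiple {X} {Z} X≢0 det≡0 with inverse X X≢0
  ... | i , Xi≡1 = Z * i
    , trans (ᶜ-* Z i) (linear₃ (i * i ᶜ) (- (i ᶜ * Z ᶜ)) (i * Z)
        (solve 6 (λ X X′ Z Z′ i i′ → Z′ :* i′ :- Z :* i :=
          i :* i′ :* (X :* Z′ :- X′ :* Z :- :0) :+ (:- (i′ :* Z′)) :* (X :* i :- :1) :+ i :* Z :* (X′ :* i′ :- :1))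
          refl X (X ᶜ) Z (Z ᶜ) i (i ᶜ))
        det≡0 Xi≡1 (trans (sym (ᶜ-* X i)) (trans (cong _ᶜ Xi≡1) ᶜ-1)))
    , linear₁ (- Z) (solve 3 (λ X Z i → Z :- Z :* i :* X := (:- Z) :* (X :* i :- :1)) refl X Z i) Xi≡1

-- Reflections of the shift unital in a Hermitian chart

module AffinePoints {order : ℕ} (F : FiniteField order)
                    (f : FiniteField.Carrier F → FiniteField.Carrier F) (Y : Pred (FiniteField.Carrier F) 0ℓ) where
  open FieldProperties F

  -- The points of the unital other than ∞. `Y` is the set of admissible second coordinates t θ,
  -- which a reflection in x leaves alone.
  record Affine : Set where
    constructor affine
    field
      x y : Carrier
      y∈Y : Y y

  open Affine public

  On : Affine → Carrier → Carrier → Set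
  On u a b = y u ≡ f (x u + a) - b

  -- The injective half of planarity: the first parameter of a line is determined by two of its
  -- points over different s and t.
  Secant : Set
  Secant = ∀ {s t} a a′ → s ≢ t → f (s + a) - f (t + a) ≡ f (s + a′) - f (t + a′) → a ≡ a′

  -- For even f, the line with first parameter `- x u` is symmetric about `x u`. The condition makes
  -- such a line tangent to the unital at u.
  NoDiameter : Set
  NoDiameter = ∀ {b} u v → On u (- x u) b → On v (- x u) b → x u ≡ x v

  Collinear : Affine → Affine → Affine → Set
  Collinear u v w = ∃[ a ] ∃[ b ] (On u a b × On v a b × On w a b)

  reflect : Carrier → Affine → Affine
  reflect m u = affine (m + m - x u) (y u) (y∈Y u)

  reflect-On : Even f → ∀ m u {a b} → On u a b → On (reflect m u) (- a - (m + m)) b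
  reflect-On even m u {a} {b} u∈ = trans u∈ (cong (_- b) (trans (sym (even (x u + a)))
    (cong f (solve 3 (λ x a m → :- (x :+ a) := (m :+ m :- x) :+ (:- a :- (m :+ m))) refl (x u) a m))))

  reflect-Collinear : Even f → ∀ m u v w → Collinear u v w → Collinear (reflect m u) (reflect m v) (reflect m w)
  reflect-Collinear even m u v w (a , b , u∈ , v∈ , w∈) =
    - a - (m + m) , b , reflect-On even m u u∈ , reflect-On even m v v∈ , reflect-On even m w w∈

-- In a basis P, Q, R of isotropic P, Q with ⟨P , Q⟩ ≡ 1 and ⟨R , R⟩ ≡ − 1, where P
-- is the image of ∞ and Q that of o, a point u is sent to Q + γ u R + α u P.
record HermitianChart {order : ℕ} (F : FiniteField order) (_ᶜ : FiniteField.Carrier F → FiniteField.Carrier F)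
                      (f : FiniteField.Carrier F → FiniteField.Carrier F) (Y : Pred (FiniteField.Carrier F) 0ℓ) :
                          Set where
  open FieldProperties F
  open AffinePoints F f Y
  field
    γ α         : Affine → Carrier
    isotropic   : ∀ u → α u + α u ᶜ ≡ γ u * γ u ᶜ
    realise     : ∀ g a → a + a ᶜ ≡ g * g ᶜ → ∃[ u ] (γ u ≡ g × α u ≡ a)
    γ-cong      : ∀ u v → x u ≡ x v → γ u ≡ γ v
    α-cong      : ∀ u v → x u ≡ x v → y u ≡ y v → α u ≡ α v
    γ-injective : ∀ u v → γ u ≡ γ v → x u ≡ x v
    α-injective : ∀ u v → γ u ≡ γ v → α u ≡ α v → y u ≡ y v
    collinear⇒  : ∀ u v w → Collinear u v w → (α w - α u) * (γ v - γ u) ≡ (α v - α u) * (γ w - γ u)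
    collinear⇐  : ∀ u v w → x u ≢ x v → (α w - α u) * (γ v - γ u) ≡ (α v - α u) * (γ w - γ u) → Collinear u v w

    o o′ : Affine
    x-o  : x o ≡ 0#
    γ-o  : γ o ≡ 0#
    α-o  : α o ≡ 0#
    x-o′ : x o′ ≡ x o
    y-o′ : y o′ ≢ y o

module ReflectionContradiction
  {order : ℕ} {F : FiniteField order} {_ᶜ : FiniteField.Carrier F → FiniteField.Carrier F}
  (isConjugation : IsConjugation F _ᶜ) (two≢0 : FieldProperties.two F ≢ FiniteField.0# F)
  (f : FiniteField.Carrier F → FiniteField.Carrier F) (Y : Pred (FiniteField.Carrier F) 0ℓ)
  (even : FieldProperties.Even F f) (secant : AffinePoints.Secant F f Y)
      (no-diameter : AffinePoints.NoDiameter F f Y)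
  (chart : HermitianChart F _ᶜ f Y) where
  open FieldProperties F
  open AffinePoints F f Y
  open IsConjugation isConjugation
  open FixedFieldGeometry isConjugation
  open HermitianChart chart
  open ≡-Reasoning

  -- The bijection from x-values to the γ-plane induced by the chart; by `γ-cong` the second
  -- coordinate chosen here is immaterial.
  g : Carrier → Carrier
  g s = γ (affine s (y o) (y∈Y o))

  γ≡g : ∀ u → γ u ≡ g (x u)
  γ≡g u = γ-cong u _ refl

  g-injective : ∀ {s t} → g s ≡ g t → s ≡ t
  g-injective = γ-injective _ _

  half : Carrier
  half = proj₁ (inverse two two≢0)

  two*half : two * half ≡ 1#
  two*half = proj₂ (inverse two two≢0)

  norm-fixed : ∀ z → (z * z ᶜ) ᶜ ≡ z * z ᶜ
  norm-fixed z = trans (ᶜ-* z (z ᶜ)) (trans (cong (z ᶜ *_) (involutive z)) (*-comm _ _))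

  g-surjective : ∀ z → ∃[ s ] g s ≡ z
  -- The norm of z lies in the fixed field, so half of it has trace equal to that norm.
  g-surjective z with realise z (half * (z * z ᶜ)) (trans
      (cong (half * (z * z ᶜ) +_) (trans (ᶜ-* _ _) (cong₂ _*_ (inverse-fixed ᶜ-two two*half) (norm-fixed z))))
      (linear₁ (z * z ᶜ) (solve 2 (λ h n → (h :* n :+ h :* n) :- n := n :* (:2 :* h :- :1)) refl half (z * z ᶜ))
          two*half))
  ... | u , γu≡z , _ = x u , trans (sym (γ≡g u)) γu≡z

  -- A nonzero skew element: `o′` lies over the same γ ≡ 0 as `o`, where isotropy says that α has
  -- trace zero. Multiplication by ε turns every direction into an independent one.
  ε : Carrier
  ε = α o′

  γ-o′ : γ o′ ≡ 0#
  γ-o′ = trans (γ-cong o′ o x-o′) γ-o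

  ε-skew : ε ᶜ ≡ - ε
  ε-skew = linear₁ 1# (solve 2 (λ e e′ → e′ :- (:- e) := :1 :* (e :+ e′ :- :0)) refl ε (ε ᶜ))
    (trans (isotropic o′) (trans (cong (_* γ o′ ᶜ) γ-o′) (zeroˡ _)))

  ε≢0 : ε ≢ 0#
  ε≢0 ε≡0 = y-o′ (α-injective o′ o (trans γ-o′ (sym γ-o)) (trans ε≡0 (sym α-o)))

  norm-≢0 : ∀ {X} → X ≢ 0# → X * X ᶜ ≢ 0#
  norm-≢0 X≢0 XXᶜ≡0 = X≢0 (norm-≡0 XXᶜ≡0)

  -- The determinant is - 2 ε X X ᶜ.
  det-ε : ∀ {X} → X ≢ 0# → det X (ε * X) ≢ 0#
  det-ε {X} X≢0 det≡0 = *-≢0 two≢0 (*-≢0 ε≢0 (norm-≢0 X≢0)) (linear₂ (- 1#) (X * X ᶜ)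
    (solve 4 (λ X X′ e e′ → :2 :* (e :* (X :* X′)) :- :0 :=
      (:- :1) :* ((X :* (e′ :* X′) :- X′ :* (e :* X)) :- :0) :+ X :* X′ :* (e′ :- (:- e))) refl X (X ᶜ) ε (ε ᶜ))
    (trans (cong (λ z → X * z - X ᶜ * (ε * X)) (sym (ᶜ-* ε X))) det≡0) ε-skew)

  slope : ∀ u v w → x u ≢ x v → Collinear u v w →
          ∃[ k ] (α v - α u ≡ k * (γ v - γ u) × α w - α u ≡ k * (γ w - γ u))
  slope u v w u≢v uvw with inverse (γ v - γ u) (λ X≡0 → u≢v (sym (γ-injective v u (x-y≡0⇒x≡y X≡0))))
  ... | i , Xi≡1 = (α v - α u) * i
    , linear₁ (- (α v - α u)) (solve 3 (λ a X i → a :- a :* i :* X := (:- a) :* (X :* i :- :1)) refl (α v - α u)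
        _ i) Xi≡1
    , linear₂ (- (α w - α u)) i (solve 5 (λ a c X Z i → c :- a :* i :* Z := (:- c) :* (X :* i :- :1) :+ i :*
        (c :* X :- a :* Z)) refl (α v - α u) (α w - α u) (γ v - γ u) (γ w - γ u) i) Xi≡1 (collinear⇒ u v w uvw)

  norm-difference : Affine → Affine → Carrier
  norm-difference u v = γ v * γ v ᶜ - γ u * γ u ᶜ

  norm-difference-fixed : ∀ u v → norm-difference u v ᶜ ≡ norm-difference u v
  norm-difference-fixed u v = trans (ᶜ-- _ _) (cong₂ _-_ (norm-fixed (γ v)) (norm-fixed (γ u)))

  -- Adding the conjugate of the slope relation eliminates α, since isotropy turns traces of α into
  -- norms of γ. What remains is the circle equation.
  slope-trace : ∀ u v {k} → α v - α u ≡ k * (γ v - γ u) →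
                k * (γ v - γ u) + k ᶜ * (γ v - γ u) ᶜ ≡ norm-difference u v
  slope-trace u v {k} eq = begin
    k * (γ v - γ u) + k ᶜ * (γ v - γ u) ᶜ  ≡⟨ cong (k * (γ v - γ u) +_) (ᶜ-* _ _) ⟨
    k * (γ v - γ u) + (k * (γ v - γ u)) ᶜ  ≡⟨ cong (λ z → z + z ᶜ) eq ⟨
    (α v - α u) + (α v - α u) ᶜ            ≡⟨ cong ((α v - α u) +_) (ᶜ-- _ _) ⟩
    (α v - α u) + (α v ᶜ - α u ᶜ)          ≡⟨ solve 4 (λ a b c d → (a :- b) :+ (c :- d) := (a :+ c) :- (b :+ d))
        refl (α v) (α u) (α v ᶜ) (α u ᶜ) ⟩
    (α v + α v ᶜ) - (α u + α u ᶜ)          ≡⟨ cong₂ _-_ (isotropic v) (isotropic u) ⟩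
    norm-difference u v                    ∎

  -- On the line of slope k through u, the two trace conditions on k say exactly that its vectors
  -- over `g s` and `g t` are isotropic, hence come from points of the unital.
  circle : ∀ u s t → det (g s - γ u) (g t - γ u) ≢ 0# →
           ∃[ v ] ∃[ w ] (x v ≡ s × x w ≡ t × Collinear u v w)
  circle u s t det≢0 = through (solve-trace (g s - γ u) (g t - γ u)
    (norm-difference-fixed u (affine s (y o) (y∈Y o))) (norm-difference-fixed u (affine t (y o) (y∈Y o))) det≢0)
    where
    module _ {k : Carrier} where
      a+ : Carrier → Carrier
      a+ s = α u + k * (g s - γ u)

      above : ∀ s → k * (g s - γ u) + k ᶜ * (g s - γ u) ᶜ ≡ g s * g s ᶜ - γ u * γ u ᶜ →
              ∃[ v ] (γ v ≡ g s × α v ≡ a+ s)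
      above s ks = realise (g s) (a+ s) (trans
        (cong (a+ s +_) (trans (ᶜ-+ _ _) (cong (α u ᶜ +_) (ᶜ-* k _))))
        (linear₂ 1# 1#
          (solve 6 (λ a a′ kX kX′ n n′ → (a :+ kX) :+ (a′ :+ kX′) :- n := :1 :* ((kX :+ kX′) :- (n :- n′)) :+ :1
              :* ((a :+ a′) :- n′))
            refl (α u) (α u ᶜ) (k * (g s - γ u)) (k ᶜ * (g s - γ u) ᶜ) (g s * g s ᶜ) (γ u * γ u ᶜ)) ks (isotropic
                u)))

      join : ∃[ v ] (γ v ≡ g s × α v ≡ a+ s) → ∃[ w ] (γ w ≡ g t × α w ≡ a+ t) →
             ∃[ v ] ∃[ w ] (x v ≡ s × x w ≡ t × Collinear u v w)
      join (v , γv , αv) (w , γw , αw) = v , w , γ-injective v _ γv , γ-injective w _ γw , collinear⇐ u v w u≢v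
          (begin
        (α w - α u) * (γ v - γ u)    ≡⟨ cong₂ (λ a c → (a - α u) * (c - γ u)) αw γv ⟩
        (a+ t - α u) * (g s - γ u)   ≡⟨ solve 4 (λ a k X Z → (a :+ k :* Z :- a) :* X := (a :+ k :* X :- a) :* Z)
            refl (α u) k (g s - γ u) (g t - γ u) ⟩
        (a+ s - α u) * (g t - γ u)   ≡⟨ cong₂ (λ a c → (a - α u) * (c - γ u)) αv γw ⟨
        (α v - α u) * (γ w - γ u)    ∎)
        where
        u≢v : x u ≢ x v
        u≢v xu≡xv = det≢0⇒≢0ˡ det≢0 (trans (cong₂ _-_ (trans (sym γv) (γ-cong v u (sym xu≡xv))) refl)
            (-‿inverseʳ _))

    through : ∃[ k ] (k * (g s - γ u) + k ᶜ * (g s - γ u) ᶜ ≡ g s * g s ᶜ - γ u * γ u ᶜ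
                    × k * (g t - γ u) + k ᶜ * (g t - γ u) ᶜ ≡ g t * g t ᶜ - γ u * γ u ᶜ) →
              ∃[ v ] ∃[ w ] (x v ≡ s × x w ≡ t × Collinear u v w)
    through (k , ks , kt) = join (above s ks) (above t kt)

  -- With γ u as origin the circle passes through 0, so its equation loses the constant term and its
  -- parameter becomes k - γ u ᶜ.
  shifted-trace : ∀ u v {k} → α v - α u ≡ k * (γ v - γ u) →
                  (k - γ u ᶜ) * (γ v - γ u) + (k - γ u ᶜ) ᶜ * (γ v - γ u) ᶜ ≡ (γ v - γ u) * (γ v - γ u) ᶜ
  shifted-trace u v {k} kv = begin
    (k - γ u ᶜ) * X + (k - γ u ᶜ) ᶜ * X ᶜ          ≡⟨ cong₂ (λ s t → (k - γ u ᶜ) * X + s * t)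
        (trans (ᶜ-- _ _) (cong (λ z → k ᶜ - z) (involutive (γ u)))) (ᶜ-- _ _) ⟩
    (k - γ u ᶜ) * X + (k ᶜ - γ u) * (γ v ᶜ - γ u ᶜ) ≡⟨ linear₁ 1# (solve 6 (λ V U V′ U′ k k′ →
        ((k :- U′) :* (V :- U) :+ (k′ :- U) :* (V′ :- U′)) :- (V :- U) :* (V′ :- U′) :=
        :1 :* ((k :* (V :- U) :+ k′ :* (V′ :- U′)) :- (V :* V′ :- U :* U′))) refl (γ v) (γ u) (γ v ᶜ) (γ u
            ᶜ) k (k ᶜ))
        (trans (cong (λ z → k * X + k ᶜ * z) (sym (ᶜ-- _ _))) (slope-trace u v kv)) ⟩
    X * (γ v ᶜ - γ u ᶜ)                            ≡⟨ cong (X *_) (ᶜ-- _ _) ⟨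
    X * X ᶜ                                        ∎
    where X = γ v - γ u

  -- A line over the fixed field through a point of a circle meets the circle in at most one further
  -- point: for dependent X and Z the two circle equations combine to X Z X ᶜ ≡ X Z Z ᶜ.
  collinear⇒det≢0 : ∀ u v w → x u ≢ x v → x u ≢ x w → x v ≢ x w → Collinear u v w → det (γ v - γ u) (γ w - γ u) ≢ 0#
  collinear⇒det≢0 u v w u≢v u≢w v≢w uvw det≡0 = v≢w (γ-injective v w (begin
    γ v                 ≡⟨ solve 2 (λ u v → v := (v :- u) :+ u) refl (γ u) (γ v) ⟩
    X + γ u             ≡⟨ cong (_+ γ u) (involutive X) ⟨
    X ᶜ ᶜ + γ u         ≡⟨ cong (λ z → z ᶜ + γ u) Xᶜ≡Zᶜ ⟩
    Z ᶜ ᶜ + γ u         ≡⟨ cong (_+ γ u) (involutive Z) ⟩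
    Z + γ u             ≡⟨ solve 2 (λ u w → (w :- u) :+ u := w) refl (γ u) (γ w) ⟩
    γ w                 ∎))
    where
    X = γ v - γ u
    Z = γ w - γ u
    X≢0 : X ≢ 0#
    X≢0 X≡0 = u≢v (sym (γ-injective v u (x-y≡0⇒x≡y X≡0)))
    Z≢0 : Z ≢ 0#
    Z≢0 Z≡0 = u≢w (sym (γ-injective w u (x-y≡0⇒x≡y Z≡0)))

    conjugates-agree : ∀ X X′ Z Z′ κ κ′ → κ * X + κ′ * X′ ≡ X * X′ → κ * Z + κ′ * Z′ ≡ Z * Z′ →
                       X * Z′ - X′ * Z ≡ 0# → (X * Z) * X′ ≡ (X * Z) * Z′
    conjugates-agree X X′ Z Z′ κ κ′ = linear₃ (- Z) X (- κ′) (solve 6 (λ X X′ Z Z′ κ κ′ →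
      (X :* Z) :* X′ :- (X :* Z) :* Z′ := (:- Z) :* ((κ :* X :+ κ′ :* X′) :- X :* X′)
        :+ X :* ((κ :* Z :+ κ′ :* Z′) :- Z :* Z′) :+ (:- κ′) :* (X :* Z′ :- X′ :* Z :- :0)) refl X X′ Z Z′ κ κ′)

    Xᶜ≡Zᶜ : X ᶜ ≡ Z ᶜ
    Xᶜ≡Zᶜ = from-slope (slope u v w u≢v uvw)
      where
      from-slope : ∃[ k ] (α v - α u ≡ k * X × α w - α u ≡ k * Z) → X ᶜ ≡ Z ᶜ
      from-slope (k , kv , kw) = *-cancelˡ (X * Z) (*-≢0 X≢0 Z≢0)
        (conjugates-agree X (X ᶜ) Z (Z ᶜ) (k - γ u ᶜ) _ (shifted-trace u v kv) (shifted-trace u w kw) det≡0)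

  On-cong : ∀ u v {a b} → x u ≡ x v → y u ≡ y v → On u a b → On v a b
  On-cong u v {a} {b} xu≡xv yu≡yv u∈ = trans (sym yu≡yv) (trans u∈ (cong (λ z → f (z + a) - b) xu≡xv))

  halve : ∀ {s t} → s + s ≡ t + t → s ≡ t
  halve {s} {t} eq = *-cancelˡ two two≢0 (trans (double s) (trans eq (sym (double t))))
    where
    double : ∀ s → two * s ≡ s + s
    double = solve 1 (λ s → :2 :* s := s :+ s) refl

  reflected : Carrier → Carrier → Carrier
  reflected m s = m + m - s

  reflected-involutive : ∀ m s → reflected m (reflected m s) ≡ s
  reflected-involutive = solve 2 (λ m s → m :+ m :- (m :+ m :- s) := s) refl

  reflected-fixed : ∀ {m s} → reflected m s ≡ s → s ≡ m
  reflected-fixed {m} {s} eq = halve (linear₁ (- 1#)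
      (solve 2 (λ m s → (s :+ s) :- (m :+ m) := (:- :1) :* ((m :+ m :- s) :- s)) refl m s) eq)

  reflected-≢ : ∀ {m s} → s ≢ m → reflected m s ≢ m
  reflected-≢ {m} {s} s≢m eq = s≢m (linear₁ (- 1#)
      (solve 2 (λ m s → s :- m := (:- :1) :* ((m :+ m :- s) :- m)) refl m s) eq)

  -- Blocks through u over the same circle have one slope: the difference of two slopes has trace
  -- zero against two independent vectors. The points `v′`, `w′` may differ from `v`, `w` within
  -- their fibres.
  slope-unique : ∀ u v w v′ w′ → det (γ v - γ u) (γ w - γ u) ≢ 0# → x v′ ≡ x v → x w′ ≡ x w → ∀ {k k′} →
                 α v - α u ≡ k * (γ v - γ u) → α w - α u ≡ k * (γ w - γ u) →
                 α v′ - α u ≡ k′ * (γ v′ - γ u) → α w′ - α u ≡ k′ * (γ w′ - γ u) → k ≡ k′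
  slope-unique u v w v′ w′ det≢0 xv xw {k} {k′} kv kw kv′ kw′ = x-y≡0⇒x≡y
    (trace-unique (γ v - γ u) (γ w - γ u) det≢0 (vanish v v′ xv kv kv′) (vanish w w′ xw kw kw′))
    where
    vanish : ∀ v v′ → x v′ ≡ x v → α v - α u ≡ k * (γ v - γ u) → α v′ - α u ≡ k′ * (γ v′ - γ u) →
             (k - k′) * (γ v - γ u) + (k - k′) ᶜ * (γ v - γ u) ᶜ ≡ 0#
    vanish v v′ xv kv kv′ = trans (cong (λ z → (k - k′) * (γ v - γ u) + z * (γ v - γ u) ᶜ) (ᶜ-- k k′))
      (linear₂ 1# (- 1#) (solve 7 (λ k k′ l l′ X X′ n → ((k :- l) :* X :+ (k′ :- l′) :* X′) :- :0 :=
        :1 :* ((k :* X :+ k′ :* X′) :- n) :+ (:- :1) :* ((l :* X :+ l′ :* X′) :- n)) refl k (k ᶜ) k′ (k′ ᶜ) (γ v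
            - γ u) ((γ v - γ u) ᶜ) _)
        (slope-trace u v kv)
        (subst (λ z → k′ * (z - γ u) + k′ ᶜ * (z - γ u) ᶜ ≡ z * z ᶜ - γ u * γ u ᶜ) (γ-cong v′ v xv)
            (slope-trace u v′ kv′)))

  -- A block through points over s, m and the reflection of s in m would be
  -- fixed by that reflection, so it would be symmetric about m.
  reflected-dependent : ∀ m s → s ≢ m → det (g s - g m) (g (reflected m s) - g m) ≡ 0#
  reflected-dependent m s s≢m with det (g s - g m) (g (reflected m s) - g m) ≟ 0#
  ... | yes det≡0 = det≡0
  ... | no  det≢0 = ⊥-elim (impossible (circle u s (reflected m s) det≢0))
    where
    u : Affine
    u = affine m (y o) (y∈Y o)

    impossible : ¬ (∃[ v ] ∃[ w ] (x v ≡ s × x w ≡ reflected m s × Collinear u v w))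
    impossible (v , w , refl , xw , uvw@(a , b , u∈ , v∈ , w∈)) =
      conclude (slope u v w (λ m≡s → s≢m (sym m≡s)) uvw)
          (slope u v′ w′ (λ m≡s → s≢m (sym m≡s)) (a′ , b , u∈′ , v∈′ , w∈′))
      where
      a′ : Carrier
      a′ = - a - (m + m)

      -- The reflected block passes over the same three x-values, with the roles of v and w
      -- exchanged.
      v′ w′ : Affine
      v′ = affine s (y w) (y∈Y w)
      w′ = affine (reflected m s) (y v) (y∈Y v)

      u∈′ : On u a′ b
      u∈′ = On-cong (reflect m u) u (solve 1 (λ m → m :+ m :- m := m) refl m) refl (reflect-On even m u u∈)

      v∈′ : On v′ a′ b
      v∈′ = On-cong (reflect m w) v′ (trans (cong (reflected m) xw) (reflected-involutive m s)) refl
          (reflect-On even m w w∈)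

      w∈′ : On w′ a′ b
      w∈′ = reflect-On even m v v∈

      γv′ : γ v′ ≡ γ v
      γv′ = γ-cong v′ v refl

      γw : γ w ≡ g (reflected m s)
      γw = trans (γ≡g w) (cong g xw)

      conclude : ∃[ k ] (α v - α u ≡ k * (γ v - γ u) × α w - α u ≡ k * (γ w - γ u)) →
                 ∃[ k ] (α v′ - α u ≡ k * (γ v′ - γ u) × α w′ - α u ≡ k * (γ w′ - γ u)) → ⊥
      conclude (k , kv , kw) (k′ , kv′ , kw′) = s≢m
          (sym (no-diameter u v (subst (λ a → On u a b) a≡-m u∈) (subst (λ a → On v a b) a≡-m v∈)))
        where
        -- Both blocks contain u and lie over one circle, so the equal slopes put them through the
        -- same point over s.
        k≡k′ : k ≡ k′
        k≡k′ = slope-unique u v w v′ w′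
          (λ det≡0 → det≢0 (trans (sym (cong₂ (λ X Z → det (X - g m) (Z - g m)) (γ≡g v) γw)) det≡0)) refl
              (sym xw) kv kw kv′ kw′

        αv′ : α v′ ≡ α v
        αv′ = linear₂ 1# (- 1#) (solve 4 (λ p q r t → p :- q := :1 :* ((p :- r) :- t) :+ (:- :1) :*
            ((q :- r) :- t)) refl (α v′) (α v) (α u) (k * (γ v - γ u)))
          (trans kv′ (cong₂ (λ k X → k * (X - γ u)) (sym k≡k′) γv′)) kv

        v∈″ : On v a′ b
        v∈″ = On-cong v′ v refl (α-injective v′ v γv′ αv′) v∈′

        difference : ∀ {a} → On u a b → On v a b → f (m + a) - f (s + a) ≡ y u - y v
        difference {a} u∈ v∈ = linear₂ (- 1#) 1# (solve 5
            (λ p q b r t → (p :- q) :- (r :- t) := (:- :1) :* (r :- (p :- b)) :+ :1 :* (t :- (q :- b))) refl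
                (f (m + a)) (f (s + a)) b (y u) (y v)) u∈ v∈

        -- Both lines join u and v, so their first parameters a and - a - 2m coincide; this is the
        -- symmetric line excluded by `no-diameter`.
        a≡-m : a ≡ - m
        a≡-m = halve (linear₁ 1# (solve 2 (λ a m → (a :+ a) :- ((:- m) :+ (:- m)) := :1 :*
            (a :- (:- a :- (m :+ m)))) refl a m)
          (secant a a′ (λ m≡s → s≢m (sym m≡s)) (trans (difference u∈ v∈) (sym (difference u∈′ v∈″)))))

  -- Blocks witness independence rather than dependence, hence the contrapositive: independent
  -- images lie under a block, and its reflection lies over r, s and t.
  reflection-preserves-dependence : ∀ m r s t → det (g s - g r) (g t - g r) ≡ 0# →
    det (g (reflected m s) - g (reflected m r)) (g (reflected m t) - g (reflected m r)) ≡ 0#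
  reflection-preserves-dependence m r s t dep with r ≟ s | r ≟ t | s ≟ t
  ... | yes refl | _        | _        = det-≡0ˡ _ (-‿inverseʳ _)
  ... | no _     | yes refl | _        = det-≡0ʳ _ (-‿inverseʳ _)
  ... | no _     | no _     | yes refl = det-self _
  ... | no r≢s   | no r≢t   | no s≢t   with det (g (reflected m s) - g (reflected m r))
      (g (reflected m t) - g (reflected m r)) ≟ 0#
  ...   | yes det≡0 = det≡0
  ...   | no  det≢0 = ⊥-elim (impossible (circle (affine (reflected m r) (y o) (y∈Y o)) (reflected m s)
      (reflected m t) det≢0))
    where
    impossible : ¬ (∃[ v ] ∃[ w ] (x v ≡ reflected m s × x w ≡ reflected m t × Collinear
        (affine (reflected m r) (y o) (y∈Y o)) v w))
    impossible (v , w , xv , xw , uvw) = collinear⇒det≢0 u′ v′ w′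
      (λ eq → r≢s (trans (sym xu′) (trans eq xv′))) (λ eq → r≢t (trans (sym xu′) (trans eq xw′)))
          (λ eq → s≢t (trans (sym xv′) (trans eq xw′)))
      (reflect-Collinear even m (affine (reflected m r) (y o) (y∈Y o)) v w uvw)
      (trans (cong₂ det (cong₂ _-_ (over v′ xv′) (over u′ xu′)) (cong₂ _-_ (over w′ xw′) (over u′ xu′))) dep)
      where
      u′ v′ w′ : Affine
      u′ = reflect m (affine (reflected m r) (y o) (y∈Y o))
      v′ = reflect m v
      w′ = reflect m w

      xu′ : x u′ ≡ r
      xu′ = reflected-involutive m r
      xv′ : x v′ ≡ s
      xv′ = trans (cong (reflected m) xv) (reflected-involutive m s)
      xw′ : x w′ ≡ t
      xw′ = trans (cong (reflected m) xw) (reflected-involutive m t)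

      over : ∀ u {s} → x u ≡ s → γ u ≡ g s
      over u xu = trans (γ≡g u) (cong g xu)

  δ : Carrier → Carrier → Carrier
  δ m s = g s - g m

  δ≢0 : ∀ {m s} → s ≢ m → δ m s ≢ 0#
  δ≢0 s≢m δ≡0 = s≢m (g-injective (x-y≡0⇒x≡y δ≡0))

  -- The factor by which the reflection in m acts at `g s`, seen from the centre; at this stage it
  -- may vary with s.
  Scalar : Carrier → Carrier → Carrier → Set
  Scalar m s l = l ᶜ ≡ l × δ m (reflected m s) ≡ l * δ m s

  scalar : ∀ m s → s ≢ m → ∃ (Scalar m s)
  scalar m s s≢m = dependent⇒multiple (δ≢0 s≢m) (reflected-dependent m s s≢m)

  det-multiple : ∀ W {r} → r ᶜ ≡ r → det W (r * W) ≡ 0#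
  det-multiple W {r} rᶜ≡r = trans (cong (λ z → W * z - W ᶜ * (r * W)) (trans (ᶜ-* r W) (cong (_* W ᶜ) rᶜ≡r)))
    (solve 3 (λ W W′ r → W :* (r :* W′) :- W′ :* (r :* W) := :0) refl W (W ᶜ) r)

  -- If the scalars differed, the line through s and t would meet its image in
  -- a point whose reflection lies on both lines, hence in a second fixed point.
  scalars-agree : ∀ m s t {l l′} → Scalar m s l → Scalar m t l′ → det (δ m s) (δ m t) ≢ 0# → l ≡ l′
  scalars-agree m s t {l} {l′} (lᶜ , ls) (l′ᶜ , l′t) det≢0 with l ≟ l′
  ... | yes l≡l′ = l≡l′
  ... | no  l≢l′ = ⊥-elim (meet (inverse (l - l′) (x≢y⇒x-y≢0 l≢l′)))
    where
    S T : Carrier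
    S = δ m s
    T = δ m t

    meet : ¬ (∃[ i ] (l - l′) * i ≡ 1#)
    meet (i , li≡1) = at-point (g-surjective (g m + Z))
      where
      -- Z is where the line through S and T meets the line through l S and l′ T. Comparing
      -- coefficients gives e = a l and 1 - e = (1 - a) l′, hence a = (1 - l′) / (l - l′).
      a e Z : Carrier
      a = (1# - l′) * i
      e = a * l
      Z = e * S + (1# - e) * T

      aᶜ : a ᶜ ≡ a
      aᶜ = trans (ᶜ-* _ _) (cong₂ _*_ (trans (ᶜ-- _ _) (cong₂ _-_ ᶜ-1 l′ᶜ))
        (inverse-fixed (trans (ᶜ-- _ _) (cong₂ _-_ lᶜ l′ᶜ)) li≡1))

      eᶜ : e ᶜ ≡ e
      eᶜ = trans (ᶜ-* a l) (cong₂ _*_ aᶜ lᶜ)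

      Zᶜ : Z ᶜ ≡ e * S ᶜ + (1# - e) * T ᶜ
      Zᶜ = trans (ᶜ-+ _ _) (cong₂ _+_ (trans (ᶜ-* e S) (cong (_* S ᶜ) eᶜ))
        (trans (ᶜ-* _ T) (cong (_* T ᶜ) (trans (ᶜ-- 1# e) (cong₂ _-_ ᶜ-1 eᶜ)))))

      Z≢0 : Z ≢ 0#
      Z≢0 Z≡0 = det≢0 (linear₂ (T ᶜ - S ᶜ) (S - T)
        (solve 5 (λ S S′ T T′ e → (S :* T′ :- S′ :* T) :- :0 :=
          (T′ :- S′) :* ((e :* S :+ (:1 :- e) :* T) :- :0) :+ (S :- T) :*
              ((e :* S′ :+ (:1 :- e) :* T′) :- :0)) refl S (S ᶜ) T (T ᶜ) e)
        Z≡0 (trans (sym Zᶜ) (trans (cong _ᶜ Z≡0) ᶜ-0)))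

      at-point : ¬ (∃[ z ] g z ≡ g m + Z)
      at-point (z , gz) = z≢m (fixed (scalar m z z≢m))
        where
        δz : δ m z ≡ Z
        δz = trans (cong (_- g m) gz) (solve 2 (λ m Z → m :+ Z :- m := Z) refl (g m) Z)

        z≢m : z ≢ m
        z≢m refl = Z≢0 (trans (sym δz) (-‿inverseʳ _))

        W : Carrier
        W = g (reflected m t) - g (reflected m s)

        on-image : g z - g (reflected m s) ≡ (1# - a) * W
        on-image = linear₄ 1# (- a) (- (1# - a)) T
          (solve 10 (λ gz gm s′ t′ S T l l′ a i →
            (gz :- s′) :- (:1 :- a) :* (t′ :- s′) :=
            :1 :* (gz :- (gm :+ (a :* l :* S :+ (:1 :- a :* l) :* T)))
            :+ (:- a) :* ((s′ :- gm) :- l :* S)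
            :+ (:- (:1 :- a)) :* ((t′ :- gm) :- l′ :* T)
            :+ T :* ((:1 :- a :* l) :- (:1 :- a) :* l′)) refl (g z) (g m) (g (reflected m s)) (g
                (reflected m t)) S T l l′ a i)
          gz ls l′t
          (linear₁ (- (1# - l′)) (solve 3 (λ l l′ i → (:1 :- (:1 :- l′) :* i :* l) :- (:1 :- (:1 :- l′) :* i) :*
              l′ := (:- (:1 :- l′)) :* ((l :- l′) :* i :- :1)) refl l l′ i) li≡1)

        back-on-line : det (g t - g s) (g (reflected m z) - g s) ≡ 0#
        back-on-line = subst₂ (λ s t → det (g t - g s) (g (reflected m z) - g s) ≡ 0#) (reflected-involutive m s)
            (reflected-involutive m t)
          (reflection-preserves-dependence m (reflected m s) (reflected m t) z
            (trans (cong (det W) on-image) (det-multiple W (trans (ᶜ-- 1# a) (cong₂ _-_ ᶜ-1 aᶜ)))))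

        fixed : ∃ (Scalar m z) → z ≡ m
        fixed (n , nᶜ , nz) = reflected-fixed (g-injective (begin
          g (reflected m z)         ≡⟨ solve 2 (λ p q → p := (p :- q) :+ q) refl (g (reflected m z)) (g m) ⟩
          δ m (reflected m z) + g m ≡⟨ cong (_+ g m) (trans nz (trans (cong (_* δ m z) n≡1) (*-identityˡ _))) ⟩
          δ m z + g m               ≡⟨ solve 2 (λ p q → (p :- q) :+ q := p) refl (g z) (g m) ⟩
          g z                       ∎))
          where
          image : g (reflected m z) - g s ≡ n * Z - S
          image = trans (solve 3 (λ p q r → p :- r := (p :- q) :- (r :- q)) refl (g (reflected m z)) (g m) (g s))
              (cong (_- S) (trans nz (cong (n *_) δz)))

          TS : g t - g s ≡ T - S
          TS = solve 3 (λ t s m → t :- s := (t :- m) :- (s :- m)) refl (g t) (g s) (g m)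

          expanded : (T - S) * (n * (e * S ᶜ + (1# - e) * T ᶜ) - S ᶜ) - (T ᶜ - S ᶜ) * (n * Z - S) ≡ 0#
          expanded = trans (sym (cong₂ (λ p q → (T - S) * p - q * (n * Z - S))
              (trans (ᶜ-- _ _) (cong (_- S ᶜ) (trans (ᶜ-* n Z) (cong₂ _*_ nᶜ Zᶜ)))) (ᶜ-- T S)))
            (trans (cong₂ det (sym TS) (sym image)) back-on-line)

          -- The left side of `expanded` equals det S T · (1 - n): the line through S and T misses
          -- the centre, so it contains only one multiple of Z.
          n≡1 : n ≡ 1#
          n≡1 = sym (x-y≡0⇒x≡y (integral (linear₁ 1#
              (solve 6 (λ S S′ T T′ n e → (S :* T′ :- S′ :* T) :* (:1 :- n) :- :0 :=
              :1 :* (((T :- S) :* (n :* (e :* S′ :+ (:1 :- e) :* T′) :- S′) :- (T′ :- S′) :*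
                  (n :* (e :* S :+ (:1 :- e) :* T) :- S)) :- :0)) refl S (S ᶜ) T (T ᶜ) n e) expanded) det≢0))

  -- The points over s and its reflection are on one line through the centre, so their scalars are
  -- compared through a third direction ε δ. Their equality and involutivity give l² ≡ 1, while l ≡
  -- 1 would fix s.
  central : ∀ m s → g (reflected m s) ≡ g m + g m - g s
  central m s with s ≟ m
  ... | yes refl = trans (cong g (solve 1 (λ m → m :+ m :- m := m) refl m))
      (solve 1 (λ m → m := m :+ m :- m) refl (g m))
  ... | no  s≢m  = at-point (g-surjective (g m + ε * δ m s))
    where
    at-point : ∃[ t ] g t ≡ g m + ε * δ m s → g (reflected m s) ≡ g m + g m - g s
    at-point (t , gt) = conclude (scalar m s s≢m) (scalar m (reflected m s) (reflected-≢ s≢m)) (scalar m t t≢m)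
      where
      δt : δ m t ≡ ε * δ m s
      δt = trans (cong (_- g m) gt) (solve 2 (λ m Z → m :+ Z :- m := Z) refl (g m) (ε * δ m s))

      t≢m : t ≢ m
      t≢m refl = *-≢0 ε≢0 (δ≢0 s≢m) (trans (sym δt) (-‿inverseʳ _))

      st-independent : det (δ m s) (δ m t) ≢ 0#
      st-independent det≡0 = det-ε (δ≢0 s≢m) (trans (cong (det (δ m s)) (sym δt)) det≡0)

      conclude : ∃ (Scalar m s) → ∃ (Scalar m (reflected m s)) → ∃ (Scalar m t) → g (reflected m s) ≡ g m + g m -
          g s
      conclude (l , ls@(lᶜ , lδ)) (l″ , ls″@(_ , l″δ)) (l′ , lt) =
        linear₂ 1# (g s - g m) (solve 4 (λ r m s l → r :- (m :+ m :- s) := :1 :* ((r :- m) :- l :* (s :- m)) :+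
            (s :- m) :* (l :- (:- :1))) refl (g (reflected m s)) (g m) (g s) l)
          lδ l≡-1
        where
        l≢0 : l ≢ 0#
        l≢0 refl = δ≢0 (reflected-≢ s≢m) (trans lδ (zeroˡ _))

        image-independent : det (δ m (reflected m s)) (δ m t) ≢ 0#
        image-independent det≡0 = *-≢0 l≢0 st-independent (trans
          (trans (solve 5 (λ l X X′ Y Y′ → l :* (X :* Y′ :- X′ :* Y) := l :* X :* Y′ :- l :* X′ :* Y) refl l
              (δ m s) (δ m s ᶜ) (δ m t) (δ m t ᶜ))
            (cong₂ (λ p q → p * δ m t ᶜ - q * δ m t) (sym lδ)
              (sym (trans (cong _ᶜ lδ) (trans (ᶜ-* _ _) (cong (_* δ m s ᶜ) lᶜ))))))
          det≡0)

        l″≡l : l″ ≡ l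
        l″≡l = trans (scalars-agree m (reflected m s) t ls″ lt image-independent)
            (sym (scalars-agree m s t ls lt st-independent))

        square : δ m s * (l * l - 1#) ≡ 0#
        square = linear₃ (- 1#) (- l) (- δ m (reflected m s))
          (solve 4 (λ X R l l″ → X :* (l :* l :- :1) :- :0 := (:- :1) :* (X :- l″ :* R) :+ (:- l) :*
              (R :- l :* X) :+ (:- R) :* (l″ :- l))
            refl (δ m s) (δ m (reflected m s)) l l″)
          (trans (cong (λ z → g z - g m) (sym (reflected-involutive m s))) l″δ) lδ l″≡l

        l-1≢0 : l - 1# ≢ 0#
        l-1≢0 l-1≡0 = s≢m (reflected-fixed (g-injective (linear₂ 1# (g s - g m)
          (solve 4 (λ r m s l → r :- s := :1 :* ((r :- m) :- l :* (s :- m)) :+ (s :- m) :* (l :- :1)) refl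
              (g (reflected m s)) (g m) (g s) l)
          lδ (x-y≡0⇒x≡y l-1≡0))))

        l≡-1 : l ≡ - 1#
        l≡-1 = linear₁ 1# (solve 1 (λ l → l :- (:- :1) := :1 :* ((l :+ :1) :- :0)) refl l)
          (integral (trans (solve 1 (λ l → (l :- :1) :* (l :+ :1) := l :* l :- :1) refl l)
              (integral square (δ≢0 s≢m))) l-1≢0)

  γ-reflect : ∀ m u → γ (reflect m u) ≡ g m + g m - γ u
  γ-reflect m u = trans (γ≡g (reflect m u)) (trans (central m (x u)) (cong (λ z → g m + g m - z) (sym (γ≡g u))))

  γ-over : ∀ u {s} → x u ≡ s → γ u ≡ g s
  γ-over u xu = trans (γ≡g u) (cong g xu)

  trace-at : ∀ u v {k p q p′ q′} → γ u ≡ p → γ v ≡ q → p ᶜ ≡ p′ → q ᶜ ≡ q′ → α v - α u ≡ k * (γ v - γ u) →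
             k * (q - p) + k ᶜ * (q′ - p′) ≡ q * q′ - p * p′
  trace-at u v {k} refl refl refl refl kv =
    trans (cong (λ z → k * (γ v - γ u) + k ᶜ * z) (sym (ᶜ-- _ _))) (slope-trace u v kv)

  -- The slope of a block over a circle with centre c is c ᶜ, so
  -- reflecting the circle in g m turns the slope k into 2 (g m)ᶜ − k.
  α-reflect : ∀ m u → α (reflect m u) ≡ α u - two * (g m ᶜ * (γ u - g m))
  α-reflect m u with x u ≟ m
  ... | yes refl = trans (α-cong (reflect m u) u (solve 1 (λ m → m :+ m :- m := m) refl m) refl)
    (linear₁ (two * g m ᶜ) (solve 4 (λ a G G′ M → a :- (a :- :2 :* (M :* (G :- G′))) := :2 :* M :* (G :- G′))
        refl (α u) (γ u) (g m) (g m ᶜ)) (γ≡g u))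
  ... | no  u≢m  = at-point (g-surjective (M + ε * X))
    where
    M X : Carrier
    M = g m
    X = γ u - M

    X≢0 : X ≢ 0#
    X≢0 X≡0 = u≢m (g-injective (trans (sym (γ≡g u)) (x-y≡0⇒x≡y X≡0)))

    at-point : ∃[ t ] g t ≡ M + ε * X → α (reflect m u) ≡ α u - two * (M ᶜ * X)
    -- A block through u over M and over M + ε X. Together with its reflection it gives trace
    -- equations in the independent directions X and ε X, which determine k + l.
    at-point (t , gt) = through (circle u m t independent)
      where
      W : Carrier
      W = ε * X

      independent : det (M - γ u) (g t - γ u) ≢ 0#
      independent det≡0 = det-ε X≢0 (linear₁ (- 1#)
        (solve 4 (λ X X′ W W′ → (X :* W′ :- X′ :* W) :- :0 := (:- :1) :*
            (((:- X) :* (W′ :- X′) :- (:- X′) :* (W :- X)) :- :0)) refl X (X ᶜ) W (W ᶜ))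
        (trans (cong₂ (λ p q → (- X) * p - q * (W - X)) (sym (ᶜ-- W X)) (sym (ᶜ-neg X)))
          (trans (cong₂ det (solve 2 (λ M G → :- (G :- M) := M :- G) refl M (γ u))
            (trans (solve 3 (λ M G W → W :- (G :- M) := (M :+ W) :- G) refl M (γ u) W)
                (cong (_- γ u) (sym gt)))) det≡0)))

      through : ∃[ v ] ∃[ w ] (x v ≡ m × x w ≡ t × Collinear u v w) → α (reflect m u) ≡ α u - two * (M ᶜ * X)
      through (v , w , xv , xw , uvw) = conclude (slope u v w (λ eq → u≢m (trans eq xv)) uvw)
        (slope u′ v′ w′ (λ eq → u≢m (trans (sym (reflected-involutive m (x u)))
            (trans (cong (reflected m) (trans eq xv′)) (solve 1 (λ m → m :+ m :- m := m) refl m))))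
          (reflect-Collinear even m u v w uvw))
        where
        u′ v′ w′ : Affine
        u′ = reflect m u
        v′ = reflect m v
        w′ = reflect m w

        xv′ : x v′ ≡ m
        xv′ = trans (cong (reflected m) xv) (solve 1 (λ m → m :+ m :- m := m) refl m)

        γw : γ w ≡ M + W
        γw = trans (γ-over w xw) gt

        γu′ : γ u′ ≡ M - X
        γu′ = trans (γ-reflect m u) (solve 2 (λ M G → M :+ M :- G := M :- (G :- M)) refl M (γ u))

        γw′ : γ w′ ≡ M - W
        γw′ = trans (γ-reflect m w) (trans (cong (λ z → M + M - z) γw)
            (solve 2 (λ M W → M :+ M :- (M :+ W) := M :- W) refl M W))

        conclude : ∃[ k ] (α v - α u ≡ k * (γ v - γ u) × α w - α u ≡ k * (γ w - γ u)) →
                   ∃[ k ] (α v′ - α u′ ≡ k * (γ v′ - γ u′) × α w′ - α u′ ≡ k * (γ w′ - γ u′)) →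
                   α u′ ≡ α u - two * (M ᶜ * X)
        -- The reflection fixes v, so passing from u to v with slope k and from v to u′ with slope l
        -- gives α u′ ≡ α u - (k + l) X. The last certificate supplies k + l ≡ 2 M ᶜ.
        conclude (k , kv , kw) (l , lv , lw) = linear₄ (- 1#) 1# 1# (- X)
          (solve 8 (λ u u′ v v′ k l M′ X → u′ :- (u :- :2 :* (M′ :* X)) :=
            (:- :1) :* ((v′ :- u′) :- l :* X) :+ :1 :* ((v :- u) :- k :* (:- X)) :+ :1 :* (v′ :- v) :+ (:- X) :*
                ((k :+ l :- :2 :* M′) :- :0))
            refl (α u) (α u′) (α v) (α v′) k l (M ᶜ) X)
          (trans lv (cong (l *_) (trans (cong₂ _-_ γv′ γu′) (solve 2 (λ M X → M :- (M :- X) := X) refl M X))))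
          (trans kv (cong (k *_) (trans (cong₂ _-_ γv γu) (solve 2 (λ M X → M :- (M :+ X) := :- X) refl M X))))
          (α-cong v′ v (trans xv′ (sym xv)) refl)
          (trace-unique X W (det-ε X≢0) cX cW)
          where
          γv : γ v ≡ M
          γv = γ-over v xv
          γv′ : γ v′ ≡ M
          γv′ = γ-over v′ xv′
          γu : γ u ≡ M + X
          γu = solve 2 (λ G M → G := M :+ (G :- M)) refl (γ u) M

          c-conj : (k + l - two * M ᶜ) ᶜ ≡ k ᶜ + l ᶜ - two * M
          c-conj = trans (ᶜ-- _ _) (cong₂ _-_ (ᶜ-+ k l) (trans (ᶜ-* two (M ᶜ)) (cong₂ _*_ ᶜ-two (involutive M))))

          t₁ : k * (M - (M + X)) + k ᶜ * (M ᶜ - (M ᶜ + X ᶜ)) ≡ M * M ᶜ - (M + X) * (M ᶜ + X ᶜ)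
          t₁ = trace-at u v γu γv (ᶜ-+ M X) refl kv
          t₂ : k * ((M + W) - (M + X)) + k ᶜ * ((M ᶜ + W ᶜ) - (M ᶜ + X ᶜ)) ≡ (M + W) * (M ᶜ + W ᶜ) - (M + X) *
              (M ᶜ + X ᶜ)
          t₂ = trace-at u w γu γw (ᶜ-+ M X) (ᶜ-+ M W) kw
          t₃ : l * (M - (M - X)) + l ᶜ * (M ᶜ - (M ᶜ - X ᶜ)) ≡ M * M ᶜ - (M - X) * (M ᶜ - X ᶜ)
          t₃ = trace-at u′ v′ γu′ γv′ (ᶜ-- M X) refl lv
          t₄ : l * ((M - W) - (M - X)) + l ᶜ * ((M ᶜ - W ᶜ) - (M ᶜ - X ᶜ)) ≡ (M - W) * (M ᶜ - W ᶜ) - (M - X) *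
              (M ᶜ - X ᶜ)
          t₄ = trace-at u′ w′ γu′ γw′ (ᶜ-- M X) (ᶜ-- M W) lw

          cX : (k + l - two * M ᶜ) * X + (k + l - two * M ᶜ) ᶜ * X ᶜ ≡ 0#
          cX = trans (cong (λ z → (k + l - two * M ᶜ) * X + z * X ᶜ) c-conj) (linear₂ (- 1#) 1#
            (solve 8 (λ k k′ l l′ M M′ X X′ → (k :+ l :- :2 :* M′) :* X :+ (k′ :+ l′ :- :2 :* M) :* X′ :- :0 :=
              (:- :1) :* ((k :* (M :- (M :+ X)) :+ k′ :* (M′ :- (M′ :+ X′))) :- (M :* M′ :- (M :+ X) :* (M′ :+ X′)))
              :+ :1 :* ((l :* (M :- (M :- X)) :+ l′ :* (M′ :- (M′ :- X′))) :- (M :* M′ :- (M :- X) :* (M′ :- X′))))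
              refl k (k ᶜ) l (l ᶜ) M (M ᶜ) X (X ᶜ)) t₁ t₃)

          cW : (k + l - two * M ᶜ) * W + (k + l - two * M ᶜ) ᶜ * W ᶜ ≡ 0#
          cW = trans (cong (λ z → (k + l - two * M ᶜ) * W + z * W ᶜ) c-conj) (linear₄ (- 1#) 1# 1# (- 1#)
            (solve 10 (λ k k′ l l′ M M′ X X′ W W′ → (k :+ l :- :2 :* M′) :* W :+ (k′ :+ l′ :- :2 :* M) :* W′ :-
                :0 :=
              (:- :1) :* ((k :* (M :- (M :+ X)) :+ k′ :* (M′ :- (M′ :+ X′))) :- (M :* M′ :- (M :+ X) :* (M′ :+ X′)))
              :+ :1 :* ((k :* ((M :+ W) :- (M :+ X)) :+ k′ :* ((M′ :+ W′) :- (M′ :+ X′))) :-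
                  ((M :+ W) :* (M′ :+ W′) :- (M :+ X) :* (M′ :+ X′)))
              :+ :1 :* ((l :* (M :- (M :- X)) :+ l′ :* (M′ :- (M′ :- X′))) :- (M :* M′ :- (M :- X) :* (M′ :- X′)))
              :+ (:- :1) :* ((l :* ((M :- W) :- (M :- X)) :+ l′ :* ((M′ :- W′) :- (M′ :- X′))) :-
                  ((M :- W) :* (M′ :- W′) :- (M :- X) :* (M′ :- X′))))
              refl k (k ᶜ) l (l ᶜ) M (M ᶜ) X (X ᶜ) W (W ᶜ)) t₁ t₂ t₃ t₄)

  -- In the shift unital, reflecting o in ν and then in μ + μ gives the reflection
  -- of o in μ + μ − ν; in the chart the two results differ by 8 ε in α.
  contradiction : ⊥
  -- For arbitrary centres the discrepancy α u₂ - α u₃ is 4 det (g μ) (g ν). The images 1 and ε are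
  -- independent, with determinant - 2 ε.
  contradiction = at-points (g-surjective 1#) (g-surjective ε)
    where
    at-points : ∃[ μ ] g μ ≡ 1# → ∃[ ν ] g ν ≡ ε → ⊥
    at-points (μ , gμ) (ν , gν) = *-≢0 two≢0 (*-≢0 two≢0 (*-≢0 two≢0 ε≢0)) eight-ε
      where
      g0 : g 0# ≡ 0#
      g0 = trans (γ-cong (affine 0# (y o) (y∈Y o)) o (sym x-o)) γ-o

      σ τ : Carrier
      σ = μ + μ
      τ = σ - ν

      gσ : g σ ≡ two
      gσ = trans (cong g (solve 1 (λ m → m :+ m := m :+ m :- :0) refl μ)) (trans (central μ 0#)
        (trans (cong₂ (λ p q → p + p - q) gμ g0) (solve 0 (:1 :+ :1 :- :0 := :2) refl)))

      gτ : g τ ≡ two - ε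
      gτ = trans (central μ ν) (cong₂ (λ p q → p + p - q) gμ gν)

      u₁ u₂ u₃ : Affine
      u₁ = reflect ν o
      u₂ = reflect σ u₁
      u₃ = reflect τ o

      α₁ : α u₁ ≡ 0# - two * ((- ε) * (0# - ε))
      α₁ = trans (α-reflect ν o) (cong₂ (λ p q → p - two * q) α-o
        (cong₂ _*_ (trans (cong _ᶜ gν) ε-skew) (cong₂ _-_ γ-o gν)))

      γ₁ : γ u₁ ≡ ε + ε - 0#
      γ₁ = trans (γ-reflect ν o) (cong₂ (λ p q → p + p - q) gν γ-o)

      α₂ : α u₂ ≡ 0# - two * ((- ε) * (0# - ε)) - two * (two * (ε + ε - 0# - two))
      α₂ = trans (α-reflect σ u₁) (cong₂ (λ p q → p - two * q) α₁
        (cong₂ _*_ (trans (cong _ᶜ gσ) ᶜ-two) (cong₂ _-_ γ₁ gσ)))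

      α₃ : α u₃ ≡ 0# - two * ((two + ε) * (0# - (two - ε)))
      α₃ = trans (α-reflect τ o) (cong₂ (λ p q → p - two * q) α-o
        (cong₂ _*_ (trans (cong _ᶜ gτ) (trans (ᶜ-- two ε)
            (trans (cong₂ _-_ ᶜ-two ε-skew) (solve 1 (λ e → :2 :- (:- e) := :2 :+ e) refl ε))))
          (cong₂ _-_ γ-o gτ)))

      x₂≡x₃ : x u₂ ≡ x u₃
      x₂≡x₃ = linear₁ 1# (solve 3 (λ s n z → (s :+ s :- (n :+ n :- z)) :- ((s :- n) :+ (s :- n) :- z) := :1 :*
          ((z :+ z) :- (:0 :+ :0))) refl σ ν (x o))
        (cong (λ z → z + z) x-o)

      eight-ε : two * (two * (two * ε)) ≡ 0#
      eight-ε = linear₁ 1# (solve 1 (λ e → :2 :* (:2 :* (:2 :* e)) :- :0 :=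
          :1 :* ((:0 :- :2 :* ((:2 :+ e) :* (:0 :- (:2 :- e)))) :-
              (:0 :- :2 :* ((:- e) :* (:0 :- e)) :- :2 :* (:2 :* (e :+ e :- :0 :- :2))))) refl ε)
        (trans (sym α₃) (trans (α-cong u₃ u₂ (sym x₂≡x₃) refl) α₂))

-- The chart of an isomorphism

module _ {S T : Setoid 0ℓ 0ℓ} (φ : Inverse S T) where
  open Inverse φ
  private
    module S = Setoid S
    module T = Setoid T

  to-injective : ∀ {x y} → to x T.≈ to y → x S.≈ y
  to-injective eq = S.trans (S.sym (inverseʳ T.refl)) (inverseʳ eq)

size-one : ∀ (S : Setoid 0ℓ 0ℓ) {P : Pred (Setoid.Carrier S) 0ℓ} → HasSize S P 1 →
           ∀ s t → P s → P t → Setoid._≈_ S s t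
size-one S size s t Ps Pt = to-injective size {s , Ps} {t , Pt}
    (all-equal (Inverse.to size (s , Ps)) (Inverse.to size (t , Pt)))
  where
  all-equal : ∀ (i j : Fin 1) → i ≡ j
  all-equal zero zero = refl

-- Lines and symmetric blocks of the shift unital

module ShiftUnital {q : ℕ} (F : FiniteField (q ℕ.^ 2)) (K : Pred (FiniteField.Carrier F) 0ℓ)
  (f : FiniteField.Carrier F → FiniteField.Carrier F) (planar : IsPlanar F f) (θ : FiniteField.Carrier F)
  (isUnital : IsUnital (Π F f) q (U F K θ)) where
  open FieldProperties F

  Y : Pred Carrier 0ℓ
  Y y = ∃[ t ] K t × y ≡ t * θ

  open AffinePoints F f Y public
  open IsUnital isUnital using (intersect)

  point : Affine → ShiftPoint F
  point u = pt (x u) (y u)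

  DesignPoint : Set
  DesignPoint = Σ (ShiftPoint F) (U F K θ)

  designPoint : Affine → DesignPoint
  designPoint u = point u , y∈Y u

  pt-x : ∀ {s t s′ t′} → _≡_ {A = ShiftPoint F} (pt s t) (pt s′ t′) → s ≡ s′
  pt-x refl = refl

  pt-y : ∀ {s t s′ t′} → _≡_ {A = ShiftPoint F} (pt s t) (pt s′ t′) → t ≡ t′
  pt-y refl = refl

  pt-cong : ∀ {s t s′ t′} → s ≡ s′ → t ≡ t′ → _≡_ {A = ShiftPoint F} (pt s t) (pt s′ t′)
  pt-cong refl refl = refl

  -- The surjective half of planarity.
  join : ∀ u v → x u ≢ x v → ∃[ a ] ∃[ b ] (On u a b × On v a b)
  join u v u≢v with proj₂ (planar (x u - x v) (x≢y⇒x-y≢0 u≢v)) (y u - y v)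
  -- The first parameter moves x v to z and x u to z + (x u - x v); the second is then read off at
  -- v.
  ... | z , hits = z - x v , f z - y v
    , trans (linear₁ (- 1#) (solve 4 (λ p f₁ f₀ r → p :- (f₁ :- (f₀ :- r)) := (:- :1) :*
        ((f₁ :- f₀) :- (p :- r))) refl (y u) (f (z + (x u - x v))) (f z) (y v)) (hits refl))
        (cong (λ t → f t - (f z - y v)) (solve 3 (λ s t z → z :+ (s :- t) := s :+ (z :- t)) refl (x u) (x v) z))
    , trans (solve 2 (λ p r → r := p :- (p :- r)) refl (f z) (y v))
        (cong (λ t → f t - (f z - y v)) (solve 2 (λ t z → z := t :+ (z :- t)) refl (x v) z))

  secant : Secant
  secant {s} {t} a a′ s≢t eq = linear₁ 1# (solve 3 (λ t a a′ → a :- a′ := :1 :* ((t :+ a) :- (t :+ a′))) refl t a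
      a′)
    (proj₁ (planar (s - t) (x≢y⇒x-y≢0 s≢t)) (trans (shifted a) (trans eq (sym (shifted a′)))))
    where
    shifted : ∀ a → f (t + a + (s - t)) - f (t + a) ≡ f (s + a) - f (t + a)
    shifted a = cong (λ z → f z - f (t + a)) (solve 3 (λ s t a → t :+ a :+ (s :- t) := s :+ a) refl s t a)

  secant-size : ∀ ℓ (s t : DesignPoint) → proj₁ s ≢ proj₁ t → _onShift_ F f (proj₁ s) ℓ → _onShift_ F f (proj₁ t)
      ℓ →
                     HasSize (IncidenceStructure.points (Π F f)) (U F K θ ∩ (λ P → _onShift_ F f P ℓ)) (q ℕ.+ 1)
  secant-size ℓ s t s≢t s∈ℓ t∈ℓ with intersect ℓ
  ... | inj₁ size = ⊥-elim (s≢t (size-one (IncidenceStructure.points (Π F f)) size _ _ (proj₂ s , s∈ℓ)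
      (proj₂ t , t∈ℓ)))
  ... | inj₂ size = size

  module _ (even : Even f) (two≢0 : two ≢ 0#) (q-odd : ∀ k → q ≢ k ℕ.+ k) where

    -- Such a block is invariant under the reflection in x u and contains u as
    -- its only fixed point, whereas q + 1 is even.
    no-diameter : NoDiameter
    no-diameter {b} u v u∈ v∈ with x u ≟ x v
    ... | yes eq = eq
    ... | no  u≢v = ⊥-elim (q-odd (proj₁ parity) (ℕ.+-cancelʳ-≡ 1 q _ (proj₂ parity)))
      where
      m : Carrier
      m = x u

      Block : Set
      Block = Σ (ShiftPoint F) (U F K θ ∩ (λ P → _onShift_ F f P (L (- m) b)))

      parity : ∃[ k ] q ℕ.+ 1 ≡ k ℕ.+ k ℕ.+ 1

      size : HasSize (IncidenceStructure.points (Π F f)) (U F K θ ∩ (λ P → _onShift_ F f P (L (- m) b))) (q ℕ.+ 1)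
      size = secant-size (L (- m) b) (designPoint u) (designPoint v) (u≢v ∘ pt-x) u∈ v∈

      open Inverse size using (to; from; to-cong; strictlyInverseˡ; strictlyInverseʳ)

      ρ : ShiftPoint F → ShiftPoint F
      ρ (pt s t) = pt (m + m - s) t
      ρ P        = P

      ρ-involutive : ∀ P → ρ (ρ P) ≡ P
      ρ-involutive (pt s t) = pt-cong (solve 2 (λ m s → m :+ m :- (m :+ m :- s) := s) refl m s) refl
      ρ-involutive (dir a)  = refl
      ρ-involutive ∞        = refl

      -- Reflection in m changes the first parameter a to - a - 2m, and - m is the value that stays.
      ρ-block : Block → Block
      ρ-block (pt s t , t∈ , st∈) = pt (m + m - s) t , t∈ , subst (λ a → On (reflect m (affine s t t∈)) a b)
        (solve 1 (λ m → :- (:- m) :- (m :+ m) := :- m) refl m) (reflect-On even m (affine s t t∈) st∈)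
      ρ-block (dir a , () , _)
      ρ-block (∞ , _ , ())

      proj₁-ρ-block : ∀ z → proj₁ (ρ-block z) ≡ ρ (proj₁ z)
      proj₁-ρ-block (pt s t , _)   = refl
      proj₁-ρ-block (dir a , () , _)
      proj₁-ρ-block (∞ , _ , ())

      π : Fin (q ℕ.+ 1) → Fin (q ℕ.+ 1)
      π i = to (ρ-block (from i))

      from-π : ∀ i → proj₁ (from (π i)) ≡ ρ (proj₁ (from i))
      from-π i = trans (strictlyInverseʳ (ρ-block (from i))) (proj₁-ρ-block (from i))

      π-involutive : ∀ i → π (π i) ≡ i
      π-involutive i = trans (to-cong {ρ-block (from (π i))} {from i} (trans (proj₁-ρ-block (from (π i)))
        (trans (cong ρ (from-π i)) (ρ-involutive (proj₁ (from i)))))) (strictlyInverseˡ i)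

      u-block : Block
      u-block = point u , y∈Y u , u∈

      i₀ : Fin (q ℕ.+ 1)
      i₀ = to u-block

      π-i₀ : π i₀ ≡ i₀
      π-i₀ = to-cong {ρ-block (from i₀)} {u-block}
          (trans (proj₁-ρ-block (from i₀)) (trans (cong ρ (strictlyInverseʳ u-block))
        (pt-cong (solve 1 (λ m → m :+ m :- m := m) refl m) refl)))

      fixed⇒u : ∀ (z : Block) → ρ (proj₁ z) ≡ proj₁ z → proj₁ z ≡ point u
      fixed⇒u (pt s t , _ , st∈) eq = pt-cong s≡m (trans st∈ (trans (cong (λ z → f (z + - m) - b) s≡m) (sym u∈)))
        where
        s≡m : s ≡ m
        s≡m = *-cancelˡ two two≢0 (linear₁ (- 1#) (solve 2
            (λ s m → :2 :* s :- :2 :* m := (:- :1) :* ((m :+ m :- s) :- s)) refl s m) (pt-x eq))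
      fixed⇒u (dir a , () , _)
      fixed⇒u (∞ , _ , ())

      π-unique : ∀ i → π i ≡ i → i ≡ i₀
      π-unique i πi≡i = trans (sym (strictlyInverseˡ i)) (to-cong {from i} {u-block}
        (fixed⇒u (from i) (trans (sym (from-π i)) (cong (proj₁ ∘ from) πi≡i))))

      parity = involution-odd π π-involutive i₀ π-i₀ π-unique

-- Coordinates on the Hermitian curve transported by the isomorphism

module ClassicalIsomorphism {q : ℕ} (F : FiniteField (q ℕ.^ 2))
  (isConjugation : IsConjugation F (λ z → FiniteField._^_ F z q))
  (two≢0 : FieldProperties.two F ≢ FiniteField.0# F) (q-odd : ∀ k → q ≢ k ℕ.+ k)
  (K : Pred (FiniteField.Carrier F) 0ℓ) (isSubfield : IsSubfield F K)
  (f : FiniteField.Carrier F → FiniteField.Carrier F) (planar : IsPlanar F f) (even : FieldProperties.Even F f)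
  (θ : FiniteField.Carrier F) (θ≢0 : θ ≢ FiniteField.0# F) (isUnital : IsUnital (Π F f) q (U F K θ))
  (isomorphism : design (Π F f) q (U F K θ) ≅ classicalUnital F q) where

  open FieldProperties F
  open SemiringExp semiring using (^-homo-*)
  open ShiftUnital {q} F K f planar θ isUnital
  open IsConjugation isConjugation
  open Triples F
  open HermitianForm isConjugation
  open _≅_ isomorphism using (bijection; block-image)
  open Inverse bijection using (to; from; to-cong; strictlyInverseˡ)
  open ≡-Reasoning

  private
    _ᶜ : Carrier → Carrier
    z ᶜ = z ^ q

  z^[q+1]≡norm : ∀ z → z ^ (q ℕ.+ 1) ≡ z * z ᶜ
  z^[q+1]≡norm z = trans (^-homo-* z q 1) (trans (cong (z ^ q *_) (*-identityʳ z)) (*-comm (z ^ q) z))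

  hermitian≡dot : ∀ X Y Z → X ^ (q ℕ.+ 1) + Y ^ (q ℕ.+ 1) + Z ^ (q ℕ.+ 1) ≡ dot (X , Y , Z) (conj (X , Y , Z))
  hermitian≡dot X Y Z = cong₂ _+_ (cong₂ _+_ (z^[q+1]≡norm X) (z^[q+1]≡norm Y)) (z^[q+1]≡norm Z)

  HermitianPoint : Set
  HermitianPoint = Σ (NonzeroTriple F) (HermitianCurve F q)

  triple : HermitianPoint → V
  triple h = proj₁ (proj₁ h)

  triple-≢0 : ∀ h → triple h ≢ 0ᵥ
  triple-≢0 h = proj₂ (proj₁ h)

  triple-isotropic : ∀ h → Isotropic (triple h)
  triple-isotropic (((X , Y , Z) , _) , onH) = trans (sym (hermitian≡dot X Y Z)) onH

  vec : DesignPoint → V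
  vec s = triple (to s)

  vec-injective : ∀ s t → vec s ∝ vec t → proj₁ s ≡ proj₁ t
  vec-injective s t = to-injective bijection {s} {t}

  vec-cong : ∀ s t → proj₁ s ≡ proj₁ t → vec s ∝ vec t
  vec-cong s t = to-cong {s} {t}

  -- Two points make ℓ a block, and its image is cut out by one functional c. Evaluating c at the
  -- image of ∞ tells the lines `N` from the lines `L`.
  line-image : ∀ ℓ (s t : DesignPoint) → proj₁ s ≢ proj₁ t → _onShift_ F f (proj₁ s) ℓ → _onShift_ F f (proj₁ t) ℓ →
               ∃[ c ] (c ≢ 0ᵥ × (∀ w → _onShift_ F f (proj₁ w) ℓ ⇔ dot c (vec w) ≡ 0#))
  line-image ℓ s t s≢t s∈ℓ t∈ℓ with block-image (ℓ , secant-size ℓ s t s≢t s∈ℓ t∈ℓ)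
  ... | ((c , c≢0) , _) , maps = c , c≢0 , maps

  infinity origin : DesignPoint
  infinity = ∞ , tt
  origin   = designPoint (affine 0# 0# (0# , IsSubfield.0∈ isSubfield , sym (zeroˡ θ)))

  ∞≢point : ∀ u → ∞ ≢ point u
  ∞≢point u ()

  P₀ Q₀ : V
  P₀ = vec infinity
  Q₀ = vec origin

  ∞-∝̸ : ∀ u → ¬ P₀ ∝ vec (designPoint u)
  ∞-∝̸ u = ∞≢point u ∘ vec-injective infinity (designPoint u)

  pairing≢0 : dot P₀ (conj Q₀) ≢ 0#
  pairing≢0 = isotropic-pairing≢0 P₀ Q₀ (triple-≢0 (to infinity)) (triple-≢0 (to origin))
    (triple-isotropic (to infinity)) (triple-isotropic (to origin)) (∞-∝̸ _)

  -- The inverse is conjugated because the form is conjugate-linear in its second argument.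
  scale : Carrier
  scale = proj₁ (inverse (dot P₀ (conj Q₀)) pairing≢0) ᶜ

  Q₁ : V
  Q₁ = scale ·ᵥ Q₀

  dot-scaleˡ : ∀ k v w → dot (k ·ᵥ v) w ≡ k * dot v w
  dot-scaleˡ k v w = trans (dot-comm (k ·ᵥ v) w) (trans (dot-scale w k v) (cong (k *_) (dot-comm w v)))

  Q₁-isotropic : Isotropic Q₁
  Q₁-isotropic = trans (dot-scaleˡ scale Q₀ (conj Q₁))
      (trans (cong (scale *_) (trans (cong (dot Q₀) (conj-scale scale Q₀))
    (trans (dot-scale Q₀ (scale ᶜ) (conj Q₀)) (trans (cong (scale ᶜ *_) (triple-isotropic (to origin)))
        (zeroʳ _))))) (zeroʳ _))

  P₀Q₁ : dot P₀ (conj Q₁) ≡ 1#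
  P₀Q₁ = begin
    dot P₀ (conj Q₁)                ≡⟨ cong (dot P₀) (conj-scale scale Q₀) ⟩
    dot P₀ (scale ᶜ ·ᵥ conj Q₀)     ≡⟨ dot-scale P₀ (scale ᶜ) (conj Q₀) ⟩
    scale ᶜ * dot P₀ (conj Q₀)      ≡⟨ cong (_* dot P₀ (conj Q₀)) (involutive _) ⟩
    _ * dot P₀ (conj Q₀)            ≡⟨ *-comm _ _ ⟩
    dot P₀ (conj Q₀) * _            ≡⟨ proj₂ (inverse (dot P₀ (conj Q₀)) pairing≢0) ⟩
    1#                              ∎

  open Frame P₀ Q₁ (triple-isotropic (to infinity)) Q₁-isotropic P₀Q₁

  A-scale : ∀ k v → A (k ·ᵥ v) ≡ k * A v
  A-scale k v = dot-scaleˡ k v (conj Q₁)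

  B-scale : ∀ k v → B (k ·ᵥ v) ≡ k * B v
  B-scale k v = dot-scaleˡ k v (conj P₀)

  C-scale : ∀ k v → C (k ·ᵥ v) ≡ k * C v
  C-scale k v = trans (cong -_ (dot-scaleˡ k v (cross P₀ Q₁)))
      (solve 2 (λ k c → :- (k :* c) := k :* (:- c)) refl k _)

  coordinates : Affine → V
  coordinates u = vec (designPoint u)

  B≢0 : ∀ u → B (coordinates u) ≢ 0#
  B≢0 u = isotropic-B≢0 (triple-≢0 (to (designPoint u))) (triple-isotropic (to (designPoint u))) (∞-∝̸ u)

  unit : Affine → Carrier
  unit u = proj₁ (inverse (B (coordinates u)) (B≢0 u))

  B*unit : ∀ u → B (coordinates u) * unit u ≡ 1#
  B*unit u = proj₂ (inverse (B (coordinates u)) (B≢0 u))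

  -- Affine coordinates on the complement of the tangent B ≡ 0 at `P₀`, which contains no other
  -- point of the curve.
  γ α : Affine → Carrier
  γ u = C (coordinates u) * unit u
  α u = A (coordinates u) * unit u

  C≡γB : ∀ u → C (coordinates u) ≡ γ u * B (coordinates u)
  C≡γB u = linear₁ (- C (coordinates u)) (solve 3 (λ c b i → c :- c :* i :* b := (:- c) :* (b :* i :- :1)) refl
      (C (coordinates u)) (B (coordinates u)) (unit u)) (B*unit u)

  A≡αB : ∀ u → A (coordinates u) ≡ α u * B (coordinates u)
  A≡αB u = linear₁ (- A (coordinates u)) (solve 3 (λ c b i → c :- c :* i :* b := (:- c) :* (b :* i :- :1)) refl
      (A (coordinates u)) (B (coordinates u)) (unit u)) (B*unit u)

  chart-of : ∀ u v → coordinates u ∝ v → γ u * B v ≡ C v × α u * B v ≡ A v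
  chart-of u _ (k , _ , refl) = ratio (C-scale k (coordinates u)) (C≡γB u) , ratio (A-scale k (coordinates u))
      (A≡αB u)
    where
    ratio : ∀ {c c′ g} → c′ ≡ k * c → c ≡ g * B (coordinates u) → g * B (k ·ᵥ coordinates u) ≡ c′
    ratio {c} {c′} {g} c′≡kc c≡gB = trans (cong (g *_) (B-scale k (coordinates u)))
      (trans (solve 3 (λ g k b → g :* (k :* b) := k :* (g :* b)) refl g k _)
          (trans (cong (k *_) (sym c≡gB)) (sym c′≡kc)))

  isotropic : ∀ u → α u + α u ᶜ ≡ γ u * γ u ᶜ
  isotropic u = begin
    A v * i + (A v * i) ᶜ        ≡⟨ cong (A v * i +_) (ᶜ-* (A v) i) ⟩
    A v * i + A v ᶜ * i ᶜ        ≡⟨ linear₃ (i * i ᶜ) (- (A v ᶜ * i ᶜ)) (- (A v * i))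
        (solve 8 (λ a a′ b b′ c c′ i i′ → (a :* i :+ a′ :* i′) :- c :* i :* (c′ :* i′) :=
          i :* i′ :* ((a :* b′ :+ b :* a′ :- c :* c′) :- :0) :+ (:- (a′ :* i′)) :* (b :* i :- :1) :+
              (:- (a :* i)) :* (b′ :* i′ :- :1))
          refl (A v) (A v ᶜ) (B v) (B v ᶜ) (C v) (C v ᶜ) i (i ᶜ))
        (trans (sym (norm-expansion v)) (triple-isotropic (to (designPoint u)))) (B*unit u)
        (trans (sym (ᶜ-* (B v) i)) (trans (cong _ᶜ (B*unit u)) ᶜ-1)) ⟩
    C v * i * (C v ᶜ * i ᶜ)      ≡⟨ cong (C v * i *_) (ᶜ-* (C v) i) ⟨
    C v * i * (C v * i) ᶜ        ∎
    where
    v = coordinates u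
    i = unit u

  same-point : ∀ u v → γ u ≡ γ v → α u ≡ α v → point u ≡ point v
  same-point u v γ≡ α≡ = vec-injective (designPoint u) (designPoint v)
      (∝-nonzero (triple-≢0 (to (designPoint v))) (begin
    coordinates v                                      ≡⟨ expansion (coordinates v) ⟩
    combination (A (coordinates v)) (B (coordinates v)) (C (coordinates v))
      ≡⟨ triple-≡ (rescale _ _ _) (rescale _ _ _) (rescale _ _ _) ⟩
    k ·ᵥ combination (A (coordinates u)) (B (coordinates u)) (C (coordinates u)) ≡⟨ cong (k ·ᵥ_)
        (expansion (coordinates u)) ⟨
    k ·ᵥ coordinates u ∎))
    where
    k : Carrier
    k = B (coordinates v) * unit u

    rescale : ∀ p q r → A (coordinates v) * p + B (coordinates v) * q + C (coordinates v) * r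
                      ≡ k * (A (coordinates u) * p + B (coordinates u) * q + C (coordinates u) * r)
    rescale p q r = trans (cong₂ (λ a c → a * p + B (coordinates v) * q + c * r)
        (trans (A≡αB v) (cong (_* B (coordinates v)) (sym α≡)))
            (trans (C≡γB v) (cong (_* B (coordinates v)) (sym γ≡))))
      (linear₁ (- (B (coordinates v) * q)) (solve 8 (λ a b c b′ i p q r →
        (a :* i :* b′ :* p :+ b′ :* q :+ c :* i :* b′ :* r) :- b′ :* i :* (a :* p :+ b :* q :+ c :* r) :=
        (:- (b′ :* q)) :* (b :* i :- :1)) refl (A (coordinates u)) (B (coordinates u)) (C (coordinates u)) (B
            (coordinates v)) (unit u) p q r) (B*unit u))

  chart-cong : ∀ u v → point u ≡ point v → γ u ≡ γ v × α u ≡ α v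
  chart-cong u v eq = cancel (trans (proj₁ ratios) (C≡γB v)) , cancel (trans (proj₂ ratios) (A≡αB v))
    where
    ratios : γ u * B (coordinates v) ≡ C (coordinates v) × α u * B (coordinates v) ≡ A (coordinates v)
    ratios = chart-of u (coordinates v) (vec-cong (designPoint u) (designPoint v) eq)

    cancel : ∀ {s t} → s * B (coordinates v) ≡ t * B (coordinates v) → s ≡ t
    cancel eq = *-cancelˡ (B (coordinates v)) (B≢0 v) (trans (*-comm _ _) (trans eq (*-comm _ _)))

  -- The vector a P + Q + g R is isotropic by the hypothesis, hence the image of a design point;
  -- since B is 1 on it, that point is not ∞.
  realise : ∀ g a → a + a ᶜ ≡ g * g ᶜ → ∃[ u ] (γ u ≡ g × α u ≡ a)
  realise g a eq = preimage (from h) (strictlyInverseˡ h)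
    where
    v : V
    v = combination a 1# g

    v≢0 : v ≢ 0ᵥ
    v≢0 v≡0 = 1≢0 (trans (sym (B-combination a 1# g)) (trans (cong B v≡0)
      (trans (dot-comm 0ᵥ (conj P₀)) (solve 3 (λ x y z → x :* :0 :+ y :* :0 :+ z :* :0 := :0) refl _ _ _))))

    v-isotropic : Isotropic v
    v-isotropic = trans (norm-expansion v) (begin
      A v * B v ᶜ + B v * A v ᶜ - C v * C v ᶜ  ≡⟨ cong₂ (λ s t → s - t * t ᶜ)
          (cong₂ (λ s t → s * t ᶜ + t * s ᶜ) (A-combination a 1# g) (B-combination a 1# g)) (C-combination a 1# g) ⟩
      a * 1# ᶜ + 1# * a ᶜ - g * g ᶜ            ≡⟨ cong (λ z → a * z + 1# * a ᶜ - g * g ᶜ) ᶜ-1 ⟩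
      a * 1# + 1# * a ᶜ - g * g ᶜ              ≡⟨ linear₁ 1#
          (solve 3 (λ a a′ n → (a :* :1 :+ :1 :* a′ :- n) :- :0 := :1 :* ((a :+ a′) :- n)) refl a (a ᶜ)
              (g * g ᶜ)) eq ⟩
      0#                                       ∎)

    h : HermitianPoint
    h = (v , v≢0) , trans (hermitian≡dot _ _ _) v-isotropic

    preimage : (s : DesignPoint) → vec s ∝ v → ∃[ u ] (γ u ≡ g × α u ≡ a)
    preimage (pt s t , t∈) s∝v = affine s t t∈ , simplify (proj₁ ratios) (C-combination a 1# g) , simplify
        (proj₂ ratios) (A-combination a 1# g)
      where
      ratios : γ (affine s t t∈) * B v ≡ C v × α (affine s t t∈) * B v ≡ A v
      ratios = chart-of (affine s t t∈) v s∝v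

      simplify : ∀ {s t t′} → s * B v ≡ t → t ≡ t′ → s ≡ t′
      simplify eq t≡t′ = trans (sym (*-identityʳ _))
          (trans (cong (_ *_) (sym (B-combination a 1# g))) (trans eq t≡t′))
    preimage (dir _ , ())
    preimage (∞ , _) (k , _ , v≡kP) = ⊥-elim (1≢0 (begin
      1#            ≡⟨ B-combination a 1# g ⟨
      B v           ≡⟨ cong B v≡kP ⟩
      B (k ·ᵥ P₀)   ≡⟨ B-scale k P₀ ⟩
      k * B P₀      ≡⟨ cong (k *_) B-P ⟩
      k * 0#        ≡⟨ zeroʳ k ⟩
      0#            ∎))

  value : V → Affine → Carrier
  value c u = α u * dot c P₀ + dot c Q₁ + γ u * dot c R

  dot≡B*value : ∀ c u → dot c (coordinates u) ≡ B (coordinates u) * value c u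
  dot≡B*value c u = trans (dot-expansion c (coordinates u))
      (trans (cong₂ (λ a g → a * dot c P₀ + B (coordinates u) * dot c Q₁ + g * dot c R) (A≡αB u) (C≡γB u))
    (solve 6 (λ a b g p q r → a :* b :* p :+ b :* q :+ g :* b :* r := b :* (a :* p :+ q :+ g :* r)) refl (α u)
        (B (coordinates u)) (γ u) (dot c P₀) (dot c Q₁) (dot c R)))

  value≡0 : ∀ c u → dot c (coordinates u) ≡ 0# → value c u ≡ 0#
  value≡0 c u eq = integral (trans (sym (dot≡B*value c u)) eq) (B≢0 u)

  on-line : ∀ c u → value c u ≡ 0# → dot c (coordinates u) ≡ 0#
  on-line c u eq = trans (dot≡B*value c u) (trans (cong (B (coordinates u) *_) eq) (zeroʳ _))

  nonzero-functional : ∀ c → c ≢ 0ᵥ → dot c P₀ ≡ 0# → dot c Q₁ ≡ 0# → dot c R ≡ 0# → ⊥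
  nonzero-functional (c₁ , c₂ , c₃) c≢0 cP cQ cR = c≢0 (triple-≡
    (trans (solve 3 (λ c₁ c₂ c₃ → c₁ := c₁ :* :1 :+ c₂ :* :0 :+ c₃ :* :0) refl c₁ c₂ c₃) (vanish (1# , 0# , 0#)))
    (trans (solve 3 (λ c₁ c₂ c₃ → c₂ := c₁ :* :0 :+ c₂ :* :1 :+ c₃ :* :0) refl c₁ c₂ c₃) (vanish (0# , 1# , 0#)))
    (trans (solve 3 (λ c₁ c₂ c₃ → c₃ := c₁ :* :0 :+ c₂ :* :0 :+ c₃ :* :1) refl c₁ c₂ c₃) (vanish (0# , 0# , 1#))))
    where
    vanish : ∀ v → dot (c₁ , c₂ , c₃) v ≡ 0#
    vanish v = trans (dot-expansion (c₁ , c₂ , c₃) v)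
        (trans (cong₂ _+_ (cong₂ (λ s t → A v * s + B v * t) cP cQ) (cong (C v *_) cR))
      (solve 3 (λ a b c → a :* :0 :+ b :* :0 :+ c :* :0 := :0) refl (A v) (B v) (C v)))

  equation : ∀ c u v → dot c (coordinates u) ≡ 0# → dot c (coordinates v) ≡ 0# →
             (α v - α u) * dot c P₀ + (γ v - γ u) * dot c R ≡ 0#
  equation c u v cu cv = linear₂ 1# (- 1#) (solve 7 (λ a g a′ g′ p q r →
      ((a′ :- a) :* p :+ (g′ :- g) :* r) :- :0 :=
      :1 :* ((a′ :* p :+ q :+ g′ :* r) :- :0) :+ (:- :1) :* ((a :* p :+ q :+ g :* r) :- :0)) refl (α u) (γ u) (α
          v) (γ v) (dot c P₀) (dot c Q₁) (dot c R))
    (value≡0 c v cv) (value≡0 c u cu)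

  -- Distinct points over one x share a block with ∞, so its functional kills `P₀`. Different values
  -- of γ would make it kill R and `Q₁` as well.
  γ-cong : ∀ u v → x u ≡ x v → γ u ≡ γ v
  γ-cong u v xu≡xv = by-cases (y u ≟ y v) (γ u ≟ γ v)
    where
    by-cases : Dec (y u ≡ y v) → Dec (γ u ≡ γ v) → γ u ≡ γ v
    by-cases _           (yes γ≡) = γ≡
    by-cases (yes yu≡yv) (no _)   = proj₁ (chart-cong u v (pt-cong xu≡xv yu≡yv))
    by-cases (no  yu≢yv) (no γ≢)  = ⊥-elim (vertical
        (line-image (N (x u)) (designPoint u) (designPoint v) (yu≢yv ∘ pt-y) refl (sym xu≡xv)))
      where
      vertical : ¬ (∃[ c ] (c ≢ 0ᵥ × (∀ w → _onShift_ F f (proj₁ w) (N (x u)) ⇔ dot c (vec w) ≡ 0#)))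
      vertical (c , c≢0 , maps) = nonzero-functional c c≢0 cP cQ cR
        where
        cP : dot c P₀ ≡ 0#
        cP = Equivalence.to (maps infinity) tt

        cu : dot c (coordinates u) ≡ 0#
        cu = Equivalence.to (maps (designPoint u)) refl

        cR : dot c R ≡ 0#
        cR = integral (linear₂ 1# (- (α v - α u)) (solve 6 (λ a g a′ g′ p r → (g′ :- g) :* r :- :0 :=
            :1 :* (((a′ :- a) :* p :+ (g′ :- g) :* r) :- :0) :+ (:- (a′ :- a)) :* (p :- :0)) refl (α u) (γ u) (α
                v) (γ v) (dot c P₀) (dot c R))
            (equation c u v cu (Equivalence.to (maps (designPoint v)) (sym xu≡xv))) cP)
          (x≢y⇒x-y≢0 (γ≢ ∘ sym))

        cQ : dot c Q₁ ≡ 0#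
        cQ = linear₃ 1# (- α u) (- γ u) (solve 5 (λ a g p q r → q :- :0 := :1 :* ((a :* p :+ q :+ g :* r) :- :0)
            :+ (:- a) :* (p :- :0) :+ (:- g) :* (r :- :0)) refl (α u) (γ u) (dot c P₀) (dot c Q₁) (dot c R))
          (value≡0 c u cu) cP cR

  α-cong : ∀ u v → x u ≡ x v → y u ≡ y v → α u ≡ α v
  α-cong u v xu≡xv yu≡yv = proj₂ (chart-cong u v (pt-cong xu≡xv yu≡yv))

  ShiftLineImage : Affine → Affine → Set
  ShiftLineImage u v = ∃[ a ] ∃[ b ] ∃[ c ] (On u a b × On v a b × c ≢ 0ᵥ ×
      (∀ w → _onShift_ F f (proj₁ w) (L a b) ⇔ dot c (vec w) ≡ 0#))

  join-image : ∀ u v → x u ≢ x v → ShiftLineImage u v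
  join-image u v u≢v = through (join u v u≢v)
    where
    through : ∃[ a ] ∃[ b ] (On u a b × On v a b) → ShiftLineImage u v
    through (a , b , u∈ , v∈) = a , b , proj₁ image , u∈ , v∈ , proj₂ image
      where image = line-image (L a b) (designPoint u) (designPoint v) (u≢v ∘ pt-x) u∈ v∈

  -- For different x the joining line misses ∞, so its functional is nonzero at `P₀`. With equal γ
  -- it then forces equal α, hence equal points.
  γ-injective : ∀ u v → γ u ≡ γ v → x u ≡ x v
  γ-injective u v γ≡ = by-cases (x u ≟ x v)
    where
    by-cases : Dec (x u ≡ x v) → x u ≡ x v
    by-cases (yes eq) = eq
    by-cases (no u≢v) = from-line (join-image u v u≢v)
      where
      from-line : ShiftLineImage u v → x u ≡ x v
      from-line (a , b , c , u∈ , v∈ , _ , maps) = pt-x (same-point u v γ≡ (sym (x-y≡0⇒x≡y (integral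
          (linear₂ 1# (dot c R) (solve 6 (λ a g a′ g′ p r → p :* (a′ :- a) :- :0 :=
            :1 :* (((a′ :- a) :* p :+ (g′ :- g) :* r) :- :0) :+ r :* (g :- g′)) refl (α u) (γ u) (α v) (γ v) (dot
                c P₀) (dot c R))
            (equation c u v (Equivalence.to (maps (designPoint u)) u∈)
                (Equivalence.to (maps (designPoint v)) v∈)) γ≡)
          (Equivalence.from (maps infinity))))))

  -- A nonzero determinant of the coordinate differences would force the functional of the line to
  -- vanish on `P₀` and R, and then on `Q₁`.
  collinear⇒ : ∀ u v w → Collinear u v w → (α w - α u) * (γ v - γ u) ≡ (α v - α u) * (γ w - γ u)
  collinear⇒ u v w (a , b , u∈ , v∈ , w∈) = by-cases (x u ≟ x v)
    where
    Goal : Set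
    Goal = (α w - α u) * (γ v - γ u) ≡ (α v - α u) * (γ w - γ u)

    by-cases : Dec (x u ≡ x v) → Goal
    by-cases (yes xu≡xv) = linear₂ (- (α w - α u)) (γ w - γ u) (solve 6 (λ a g a′ g′ a″ g″ →
      (a″ :- a) :* (g′ :- g) :- (a′ :- a) :* (g″ :- g) := (:- (a″ :- a)) :* (g :- g′) :+ (g″ :- g) :*
          (a :- a′)) refl (α u) (γ u) (α v) (γ v) (α w) (γ w))
      (proj₁ same) (proj₂ same)
      where
      same : γ u ≡ γ v × α u ≡ α v
      same = chart-cong u v (pt-cong xu≡xv (trans u∈ (trans (cong (λ z → f (z + a) - b) xu≡xv) (sym v∈))))
    by-cases (no u≢v) = from-line (line-image (L a b) (designPoint u) (designPoint v) (u≢v ∘ pt-x) u∈ v∈)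
      where
      from-line : ∃[ c ] (c ≢ 0ᵥ × (∀ w → _onShift_ F f (proj₁ w) (L a b) ⇔ dot c (vec w) ≡ 0#)) → Goal
      from-line (c , c≢0 , maps) = conclude (_ ≟ _)
        where
        on : ∀ z → On z a b → dot c (coordinates z) ≡ 0#
        on z = Equivalence.to (maps (designPoint z))

        Δ : Carrier
        Δ = (α w - α u) * (γ v - γ u) - (α v - α u) * (γ w - γ u)

        ΔcP : Δ * dot c P₀ ≡ 0#
        ΔcP = linear₂ (γ v - γ u) (- (γ w - γ u)) (solve 6 (λ a′ g′ a″ g″ p r → (a″ :* g′ :- a′ :* g″) :* p :- :0 :=
          g′ :* ((a″ :* p :+ g″ :* r) :- :0) :+ (:- g″) :* ((a′ :* p :+ g′ :* r) :- :0)) refl (α v - α u) (γ v -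
              γ u) (α w - α u) (γ w - γ u) (dot c P₀) (dot c R))
          (equation c u w (on u u∈) (on w w∈)) (equation c u v (on u u∈) (on v v∈))

        ΔcR : Δ * dot c R ≡ 0#
        ΔcR = linear₂ (- (α v - α u)) (α w - α u) (solve 6 (λ a′ g′ a″ g″ p r → (a″ :* g′ :- a′ :* g″) :* r :- :0 :=
          (:- a′) :* ((a″ :* p :+ g″ :* r) :- :0) :+ a″ :* ((a′ :* p :+ g′ :* r) :- :0)) refl (α v - α u) (γ v -
              γ u) (α w - α u) (γ w - γ u) (dot c P₀) (dot c R))
          (equation c u w (on u u∈) (on w w∈)) (equation c u v (on u u∈) (on v v∈))

        conclude : Dec (Δ ≡ 0#) → Goal
        conclude (yes Δ≡0) = x-y≡0⇒x≡y Δ≡0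
        conclude (no  Δ≢0) = ⊥-elim (nonzero-functional c c≢0 cP
          (linear₃ 1# (- α u) (- γ u) (solve 5 (λ a g p q r → q :- :0 := :1 :* ((a :* p :+ q :+ g :* r) :- :0) :+
              (:- a) :* (p :- :0) :+ (:- g) :* (r :- :0)) refl (α u) (γ u) (dot c P₀) (dot c Q₁) (dot c R))
            (value≡0 c u (on u u∈)) cP cR) cR)
          where
          cP : dot c P₀ ≡ 0#
          cP = integral ΔcP Δ≢0
          cR : dot c R ≡ 0#
          cR = integral ΔcR Δ≢0

  -- The value of the functional at w, multiplied by γ v - γ u, combines the determinant with its
  -- values at u and v; `γ-injective` allows the factor to be cancelled.
  collinear⇐ : ∀ u v w → x u ≢ x v → (α w - α u) * (γ v - γ u) ≡ (α v - α u) * (γ w - γ u) → Collinear u v w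
  collinear⇐ u v w u≢v eq = from-line (join-image u v u≢v)
    where
    from-line : ShiftLineImage u v → Collinear u v w
    from-line (a , b , c , u∈ , v∈ , _ , maps) = a , b , u∈ , v∈ , Equivalence.from (maps (designPoint w))
        (on-line c w (integral
        (linear₃ (dot c P₀) (γ w - γ u) (γ v - γ u) (solve 9 (λ a g a′ g′ a″ g″ p q r →
          (g′ :- g) :* (a″ :* p :+ q :+ g″ :* r) :- :0 :=
          p :* ((a″ :- a) :* (g′ :- g) :- (a′ :- a) :* (g″ :- g)) :+ (g″ :- g) :*
              (((a′ :- a) :* p :+ (g′ :- g) :* r) :- :0)
          :+ (g′ :- g) :* ((a :* p :+ q :+ g :* r) :- :0)) refl (α u) (γ u) (α v) (γ v) (α w) (γ w) (dot c
              P₀) (dot c Q₁) (dot c R))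
          eq (equation c u v (on u u∈) (on v v∈)) (value≡0 c u (on u u∈)))
        (x≢y⇒x-y≢0 (λ γ≡ → u≢v (γ-injective u v (sym γ≡))))))
      where
      on : ∀ z → On z a b → dot c (coordinates z) ≡ 0#
      on z = Equivalence.to (maps (designPoint z))

  chart : HermitianChart F _ᶜ f Y
  chart = record
    { γ           = γ
    ; α           = α
    ; isotropic   = isotropic
    ; realise     = realise
    ; γ-cong      = γ-cong
    ; α-cong      = α-cong
    ; γ-injective = γ-injective
    ; α-injective = λ u v γ≡ α≡ → pt-y (same-point u v γ≡ α≡)
    ; collinear⇒  = collinear⇒
    ; collinear⇐  = collinear⇐
    ; o           = o
    ; o′          = o′
    ; x-o         = refl
    ; γ-o         = trans (cong (_* unit o) (integral (trans (sym (C-scale scale Q₀)) C-Q₁) scale≢0)) (zeroˡ _)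
    ; α-o         = trans (cong (_* unit o) (integral (trans (sym (A-scale scale Q₀)) Q₁-isotropic) scale≢0))
        (zeroˡ _)
    ; x-o′        = refl
    ; y-o′        = θ≢0
    }
    where
    o o′ : Affine
    o  = affine 0# 0# (proj₂ origin)
    o′ = affine 0# θ (1# , IsSubfield.1∈ isSubfield , sym (*-identityˡ θ))

    scale≢0 : scale ≢ 0#
    scale≢0 scale≡0 = 1≢0 (trans (sym QP) (trans (B-scale scale Q₀) (trans (cong (_* B Q₀) scale≡0) (zeroˡ _))))

    C-Q₁ : C Q₁ ≡ 0#
    C-Q₁ = trans (cong -_ (cross-orthogonal′ P₀ Q₁)) (solve 0 (:- :0 := :0) refl)

  impossible : ⊥
  impossible = ReflectionContradiction.contradiction isConjugation two≢0 f Y even secant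
      (no-diameter even two≢0 q-odd) chart

-- Evenness of planar functions

Odd : ℕ → Set
Odd m = ∃[ k ] m ≡ 1 ℕ.+ 2 ℕ.* k

2∤⇒odd : ∀ {m} → 2 ∤ m → Odd m
2∤⇒odd {zero}        2∤m = ⊥-elim (2∤m (divides 0 refl))
2∤⇒odd {suc zero}    2∤m = 0 , refl
2∤⇒odd {suc (suc m)} 2∤m with 2∤⇒odd {m} (λ { (divides k refl) → 2∤m (divides (suc k) refl) })
... | k , refl = suc k , cong (2 ℕ.+_) (sym (ℕ.+-suc k (k ℕ.+ 0)))

odd≢double : ∀ {m} → Odd m → ∀ k → m ≢ k ℕ.+ k
odd≢double (j , refl) k eq with ∣1⇒≡1 (∣m+n∣m⇒∣n (divides k
    (trans (ℕ.+-comm (2 ℕ.* j) 1) (trans eq (solve 1 (λ k → k :+ k := k :* con 2) refl k)))) (divides j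
        (ℕ.*-comm 2 j)))
  where open ℕ-Solver.+-*-Solver
... | ()

odd-^ : ∀ {m} → Odd m → ∀ i → Odd (m ℕ.^ i)
odd-^ _              zero    = 0 , refl
odd-^ odd@(k , refl) (suc i) with odd-^ odd i
... | l , eq = k ℕ.+ l ℕ.+ 2 ℕ.* k ℕ.* l , trans (cong ((1 ℕ.+ 2 ℕ.* k) ℕ.*_) eq)
  (solve 2 (λ k l → (con 1 :+ con 2 :* k) :* (con 1 :+ con 2 :* l) := con 1 :+ con 2 :*
      (k :+ l :+ con 2 :* k :* l)) refl k l)
  where open ℕ-Solver.+-*-Solver

odd+odd : ∀ {m n} → Odd m → Odd n → ∃[ k ] m ℕ.+ n ≡ 2 ℕ.* k
odd+odd (k , refl) (l , refl) = 1 ℕ.+ k ℕ.+ l ,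
  solve 2 (λ k l → con 1 :+ con 2 :* k :+ (con 1 :+ con 2 :* l) := con 2 :* (con 1 :+ k :+ l)) refl k l
  where open ℕ-Solver.+-*-Solver

-- Each step multiplies by 9, which is 1 modulo 8.
3^odd : ∀ j → ∃[ w ] 3 ℕ.^ (1 ℕ.+ 2 ℕ.* j) ≡ 3 ℕ.+ 8 ℕ.* w
3^odd zero    = 0 , refl
3^odd (suc j) with 3^odd j
... | w , eq = 3 ℕ.+ 9 ℕ.* w , (begin
  3 ℕ.^ (1 ℕ.+ 2 ℕ.* suc j)              ≡⟨ cong (3 ℕ.^_)
      (solve 1 (λ j → con 1 :+ con 2 :* (con 1 :+ j) := con 2 :+ (con 1 :+ con 2 :* j)) refl j) ⟩
  3 ℕ.^ (2 ℕ.+ (1 ℕ.+ 2 ℕ.* j))          ≡⟨ ℕ.^-distribˡ-+-* 3 2 (1 ℕ.+ 2 ℕ.* j) ⟩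
  9 ℕ.* 3 ℕ.^ (1 ℕ.+ 2 ℕ.* j)            ≡⟨ cong (9 ℕ.*_) eq ⟩
  9 ℕ.* (3 ℕ.+ 8 ℕ.* w)                  ≡⟨ solve 1
      (λ w → con 9 :* (con 3 :+ con 8 :* w) := con 3 :+ con 8 :* (con 3 :+ con 9 :* w)) refl w ⟩
  3 ℕ.+ 8 ℕ.* (3 ℕ.+ 9 ℕ.* w)            ∎)
  where
  open ℕ-Solver.+-*-Solver
  open ≡-Reasoning

-- Coprimality to 2 n makes k odd, so 3 ^ k + 1 is 4 modulo 8 and its half is 2 modulo 4. For even k
-- the half would be odd.
coulterMatthews-exponent-even : ∀ k n → gcd k (2 ℕ.* n) ≡ 1 → ∃[ l ] (3 ℕ.^ k ℕ.+ 1) ℕ./ 2 ≡ 2 ℕ.* l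
coulterMatthews-exponent-even k n coprime with 2∤⇒odd {k}
    (λ 2∣k → 2∤1 (subst (2 ∣_) coprime (gcd-greatest 2∣k (divides n (ℕ.*-comm 2 n)))))
  where
  2∤1 : 2 ∤ 1
  2∤1 2∣1 with ∣1⇒≡1 2∣1
  ... | ()
... | j , refl with 3^odd j
...   | w , eq = 1 ℕ.+ 2 ℕ.* w , trans (cong (ℕ._/ 2) (trans (cong (ℕ._+ 1) eq)
    (solve 1 (λ w → con 3 :+ con 8 :* w :+ con 1 := con 2 :* (con 1 :+ con 2 :* w) :* con 2) refl
        w))) (ℕ.m*n/n≡m _ 2)
  where open ℕ-Solver.+-*-Solver

module Evenness {order : ℕ} (F : FiniteField order) where
  open FieldProperties F
  open SemiringExp semiring using (^-assocʳ)
  open SemiringSum semiring using (sum-cong-≗)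

  even-power : ∀ {m} → ∃[ k ] m ≡ 2 ℕ.* k → ∀ z → (- z) ^ m ≡ z ^ m
  even-power (k , refl) z = trans (sym (^-assocʳ (- z) 2 k)) (trans
    (cong (_^ k) (solve 1 (λ z → (:- z) :* ((:- z) :* :1) := z :* (z :* :1)) refl z)) (^-assocʳ z 2 k))

  -- Each exponent is a sum of two odd numbers.
  dembowskiOstrom-even : ∀ {p f} → Odd p → IsDembowskiOstrom F p f → Even f
  dembowskiOstrom-even odd (_ , a , f≡) z = trans (f≡ (- z)) (trans
    (sum-cong-≗ λ i → sum-cong-≗ λ j → cong (a i j *_)
        (even-power (odd+odd (odd-^ odd (toℕ i)) (odd-^ odd (toℕ j))) z)) (sym (f≡ z)))

  coulterMatthews-even : ∀ {p n f} → IsCoulterMatthews F p n f → Even f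
  coulterMatthews-even {n = n} (_ , k , coprime , f≡) z =
    trans (f≡ (- z)) (trans (even-power (coulterMatthews-exponent-even k n coprime) z) (sym (f≡ z)))

-- The Frobenius map as conjugation, and the conclusion

module _ {p n q : ℕ} (p-prime : Prime p) (q≡p^n : q ≡ p ℕ.^ n) (F : FiniteField (q ℕ.^ 2)) where
  open FiniteField F using (_^_; _*_; _+_; semiring; commutativeSemiring)
  open SemiringExp semiring using (^-assocʳ)
  open CommutativeSemiringExp commutativeSemiring using (^-distrib-*)
  open FiniteFieldProperties F using (x^order≡x; module Characteristic)

  order≡p^2n : q ℕ.^ 2 ≡ p ℕ.^ (n ℕ.* 2)
  order≡p^2n = trans (cong (ℕ._^ 2) q≡p^n) (ℕ.^-*-assoc p n 2)

  open Characteristic p p-prime (n ℕ.* 2) order≡p^2n public using (two≢0; ^p^-distrib-+)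

  frobenius-isConjugation : IsConjugation F (_^ q)
  frobenius-isConjugation = record
    { ᶜ-+        = λ x y → subst (λ r → (x + y) ^ r ≡ x ^ r + y ^ r) (sym q≡p^n) (^p^-distrib-+ n x y)
    ; ᶜ-*        = λ x y → ^-distrib-* x y q
    -- `q ^ 2` unfolds to q · (q · 1), which accounts for the unit law; the rest is Fermat's
    -- identity for the field.
    ; involutive = λ x → trans (^-assocʳ x q q) (trans (cong (λ r → x ^ (q ℕ.* r)) (sym (ℕ.*-identityʳ q)))
        (x^order≡x x))
    }

open import Data.Nat.Base using (_^_; _≤_)
open FiniteField using (Carrier; 0#)

theorem4p7 : (p n q : ℕ) → Prime p → 2 ∤ p → 1 ≤ n → q ≡ p ^ n →
    (F : FiniteField (q ^ 2)) →
    (Fq : Pred (Carrier F) 0ℓ) → IsSubfieldOfOrder F q Fq →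
    (f : Carrier F → Carrier F) → IsPlanar F f →
    IsDembowskiOstrom F p f ⊎ IsCoulterMatthews F p n f →
    (θ : Carrier F) → θ ≢ 0# F →
    IsUnital (Π F f) q (U F Fq θ) →
    ¬ (design (Π F f) q (U F Fq θ) ≅ classicalUnital F q)
theorem4p7 p n q p-prime 2∤p 1≤n q≡p^n F Fq isSubfieldOfOrder f planar form θ θ≢0 isUnital isomorphism =
  ClassicalIsomorphism.impossible F (frobenius-isConjugation {p} {n} p-prime q≡p^n F)
      (two≢0 {p} {n} p-prime q≡p^n F 2∤p)
    (odd≢double (subst Odd (sym q≡p^n) (odd-^ odd-p n)))
    Fq (IsSubfieldOfOrder.isSubfield isSubfieldOfOrder) f planar
    ([ dembowskiOstrom-even odd-p , coulterMatthews-even {p} {n} ]′ form) θ θ≢0 isUnital isomorphism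
  where
  open Evenness F
  odd-p : Odd p
  odd-p = 2∤⇒odd 2∤p
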